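{- For all integers $n\ge0$, $\overline{p}_{\omega}(4n+3)\equiv0\pmod{4}$ and $\overline{p}_{\omega}(8n+6)\equiv0\pmod{4}$.
   Context: An overpartition is a partition in which the first occurrence of each part size may be overlined. $\overline{p}_{\omega}(n)$ is the number of overpartitions of $n$ in which the smallest part is overlined and all odd parts are less than twice the smallest part; equivalently $\sum_{n\ge1}\overline{p}_{\omega}(n)q^n=\sum_{n\ge1}\frac{q^n(-q^{n+1};q)_n(-q^{2n+2};q^2)_{\infty}}{(1-q^n)(q^{n+1};q)_n(q^{2n+2};q^2)_{\infty}}$, where $(a;q)_n=\prod_{k=0}^{n-1}(1-aq^k)$. -}

module Defs where

open import Data.Nat using (ℕ; zero; suc; _+_; _*_; _∸_; _<ᵇ_; _≡ᵇ_; _⊓_)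
open import Data.Bool using (Bool; true; false; _∧_; _∨_; not; if_then_else_)
open import Data.Product using (_×_; _,_; proj₁)
open import Data.List using (List; []; _∷_; map; concatMap; length; filterᵇ; upTo)
open import Data.Bool.ListAction using (all; any)

-- A part of an overpartition: (size , overlined?)
Part : Set
Part = ℕ × Bool

isEven : ℕ → Bool
isEven zero = true
isEven (suc zero) = false
isEven (suc (suc n)) = isEven n

-- All lists of flagged positive parts (size ≥ 1, each either overlined or not)
-- whose sizes sum to n (ordered compositions with flags).  'fuel' ≥ n suffices.
flaggedCompositionsF : ℕ → ℕ → List (List Part)
flaggedCompositionsF _ zero = [] ∷ []
flaggedCompositionsF zero (suc _) = []
flaggedCompositionsF (suc f) (suc m) =
  concatMap (λ k → concatMap (λ b → map ((suc k , b) ∷_) (flaggedCompositionsF f (suc m ∸ suc k)))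
                             (true ∷ false ∷ []))
            (upTo (suc m))

flaggedCompositions : ℕ → List (List Part)
flaggedCompositions n = flaggedCompositionsF n n

-- Canonical form of an overpartition: parts listed in non-increasing order of size,
-- and within a block of equal sizes only the first occurrence may be overlined.
-- (consecutive (a,b),(a',b'):  a' < a,  or  a' = a and b' = false)
isOverpartitionᵇ : List Part → Bool
isOverpartitionᵇ [] = true
isOverpartitionᵇ (_ ∷ []) = true
isOverpartitionᵇ ((a , _) ∷ (a' , b') ∷ r) =
  ((a' <ᵇ a) ∨ ((a' ≡ᵇ a) ∧ not b')) ∧ isOverpartitionᵇ ((a' , b') ∷ r)

smallestPart : List Part → ℕ
smallestPart [] = 0
smallestPart ((a , _) ∷ []) = a
smallestPart ((a , _) ∷ r@(_ ∷ _)) = a ⊓ smallestPart r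

isOmegaᵇ : List Part → Bool
isOmegaᵇ [] = false
isOmegaᵇ π@(_ ∷ _) =
  let s = smallestPart π in
  any (λ { (a , b) → b ∧ (a ≡ᵇ s) }) π
  ∧ all (λ { (a , _) → isEven a ∨ (a <ᵇ 2 * s) }) π

pω : ℕ → ℕ
pω n = length (filterᵇ (λ π → isOverpartitionᵇ π ∧ isOmegaᵇ π) (flaggedCompositions n))

{-# OPTIONS --safe #-}
-- The parts of the largest and of the second largest size may be overlined freely, provided they are not the
-- smallest ones. Hence overpartitions with three or more part sizes come in fours and pω(n) ≡ τ(n) + 2 N(n)
-- (mod 4), where N(n) counts the solutions of a s + b t = n with s < t and (t even or t < 2 s). The parity of
-- N(n) is found by involutions:
--   * s < t < 2 s: with s = d + r and t = d + 2 r the equation reads (a + b)(d + r) + b r = n and is symmetric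
--     under (a , b) ↔ (d , r); fixed points write n as a sum of two squares, impossible for 4k+3 and 8k+6.
--   * t = 2 s: the solutions are as many, mod 2, as the divisors d ≡ 3 (mod 4) of n, and half of the divisors of
--     4k+3 are of that kind.
--   * t > 2 s even, n = 4k+3: these are the solutions of a s + 2 b v = n with a > 2 b. Those with a < 2 b are in
--     bijection with those with b odd, so the former are equinumerous with the solutions with b even; these are,
--     mod 2, the representations n = x² + 4 y², of which there are none.
--   * t > 2 s even, n = 2m with m = 4k+3: involutions leave τ(m) / 2 solutions and the previous case for m.
module Submission where

open import Defs
open import Data.Nat
open import Data.Nat.Divisibility using (_∣_; divides)
open import Data.Nat.DivMod using ([m+kn]%n≡m%n)
open import Data.Nat.Properties
open import Data.Nat.Tactic.RingSolver using (solve; solve-∀)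
open import Data.Bool using (Bool; true; false; _∧_; _∨_)
open import Data.Bool.ListAction using (any; all)
open import Data.Bool.Properties using (∨-zeroʳ; ∧-zeroʳ; ∧-assoc; ∧-idem; T-≡)
open import Data.Empty using (⊥; ⊥-elim)
open import Data.List using (List; []; _∷_; map; _++_; length; upTo; cartesianProduct; filter; filterᵇ; concatMap)
open import Data.List.Properties using (length-map; length-++; ∷-injectiveˡ; ∷-injectiveʳ)
open import Data.List.Membership.Propositional using (_∈_; find; lose)
open import Data.List.Membership.Propositional.Properties
open import Data.List.Membership.Propositional.Properties.WithK using (unique∧set⇒bag)
open import Data.List.Relation.Binary.BagAndSetEquality using (∼bag⇒↭)
open import Data.List.Relation.Binary.Permutation.Propositional
  using (_↭_; ↭-refl; ↭-sym; ↭-trans; prep; ↭⇒↭ₛ)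
import Data.List.Relation.Binary.Permutation.Propositional.Properties as Perm
import Data.List.Relation.Binary.Permutation.Setoid.Properties as PermSetoid
open import Data.List.Relation.Unary.All as All using (All)
open import Data.List.Relation.Unary.AllPairs as AllPairs using ()
open import Data.List.Relation.Unary.Any using (here; there)
open import Data.List.Relation.Unary.Unique.Propositional using (Unique)
import Data.List.Relation.Unary.Unique.Propositional.Properties as Uniqueₚ
open import Data.Product using (∃; ∃₂; _×_; _,_; proj₁; proj₂; swap)
open import Data.Product.Properties using (≡-dec)
open import Data.Sum using (_⊎_; inj₁; inj₂)
open import Function using (_∘_; id)
open import Function.Bundles using (Equivalence; mk⇔)
open import Level using (0ℓ)
open import Relation.Binary.Definitions using (DecidableEquality; tri<; tri≈; tri>)
open import Relation.Binary.PropositionalEquality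
open import Relation.Nullary using (¬_; yes; no)
open import Relation.Nullary.Decidable using (T?)
open import Relation.Unary using (Pred; Decidable)

private
  variable
    A B : Set
    P : Pred A 0ℓ
    Q : Pred B 0ℓ
    i j k n : ℕ

-- Finite predicates and their cardinalities

infix 4 _#_

record _#_ {A : Set} (P : Pred A 0ℓ) (k : ℕ) : Set where
  field
    elems    : List A
    size     : length elems ≡ k
    unique   : Unique elems
    sound    : ∀ {x} → x ∈ elems → P x
    complete : ∀ {x} → P x → x ∈ elems

open _#_

Unique-resp-↭ : {xs ys : List A} → xs ↭ ys → Unique xs → Unique ys
Unique-resp-↭ p = PermSetoid.Unique-resp-↭ (setoid _) (↭⇒↭ₛ p)

Unique-++⁻ˡ : ∀ (xs : List A) {ys} → Unique (xs ++ ys) → Unique xs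
Unique-++⁻ˡ []       _                 = AllPairs.[]
Unique-++⁻ˡ (x ∷ xs) (p AllPairs.∷ ps) =
  All.tabulate (λ y∈ → All.lookup p (∈-++⁺ˡ y∈)) AllPairs.∷ Unique-++⁻ˡ xs ps

Unique-++⁻ʳ : ∀ (xs : List A) {ys} → Unique (xs ++ ys) → Unique ys
Unique-++⁻ʳ []       u                = u
Unique-++⁻ʳ (x ∷ xs) (_ AllPairs.∷ u) = Unique-++⁻ʳ xs u

opaque
  -- Two complete enumerations without repetition have the same members, hence are permutations of
  -- each other.
  #-unique : P # i → P # j → i ≡ j
  #-unique F G = trans (sym (size F)) (trans (Perm.↭-length perm) (size G))
    where
    perm : elems F ↭ elems G
    perm = ∼bag⇒↭ (unique∧set⇒bag (unique F) (unique G)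
             (mk⇔ (complete G ∘ sound F) (complete F ∘ sound G)))

InjectiveOn : Pred A 0ℓ → (A → B) → Set
InjectiveOn P f = ∀ x y → P x → P y → f x ≡ f y → x ≡ y

module _ {A B C : Set} {P : Pred A 0ℓ} {Q : Pred B 0ℓ} {R : Pred C 0ℓ} (f : B → A) (g : C → A)
         (cover : ∀ x → P x → (∃ λ y → Q y × f y ≡ x) ⊎ (∃ λ z → R z × g z ≡ x))
  where

  split-list : ∀ xs → All P xs →
    ∃₂ λ ys zs → All Q ys × All R zs × xs ↭ map f ys ++ map g zs
  split-list []       All.[]       = [] , [] , All.[] , All.[] , ↭-refl
  split-list (x ∷ xs) (p All.∷ ps) with cover x p | split-list xs ps
  ... | inj₁ (y , q , refl) | ys , zs , qs , rs , e = y ∷ ys , zs , q All.∷ qs , rs , prep _ e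
  ... | inj₂ (z , r , refl) | ys , zs , qs , rs , e =
    ys , z ∷ zs , qs , r All.∷ rs ,
    ↭-trans (prep _ e) (↭-sym (Perm.shift (g z) (map f ys) (map g zs)))

  -- The list enumerating `P` is rearranged as `map f ys ++ map g zs`. Finiteness of `Q` and `R` is
  -- thus a conclusion: both inherit their enumerations from that of `P`.
  #-split : (∀ y → Q y → P (f y)) → (∀ z → R z → P (g z)) →
            InjectiveOn Q f → InjectiveOn R g →
            (∀ y z → Q y → R z → f y ≢ g z) →
            P # k → ∃₂ λ i j → Q # i × R # j × k ≡ i + j
  #-split presf presg injf injg disj F
    with ys , zs , qs , rs , e ← split-list (elems F) (All.tabulate (sound F)) =
    length ys , length zs ,
    record { elems = ys ; size = refl
           ; unique = Uniqueₚ.map⁻ (Unique-++⁻ˡ (map f ys) u)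
           ; sound = All.lookup qs ; complete = completeQ } ,
    record { elems = zs ; size = refl
           ; unique = Uniqueₚ.map⁻ (Unique-++⁻ʳ (map f ys) u)
           ; sound = All.lookup rs ; complete = completeR } ,
    trans (sym (size F)) (trans (Perm.↭-length e)
      (trans (length-++ (map f ys)) (cong₂ _+_ (length-map f ys) (length-map g zs))))
    where
    u = Unique-resp-↭ e (unique F)

    completeQ : ∀ {y} → Q y → y ∈ ys
    completeQ q with ∈-++⁻ (map f ys) (Perm.∈-resp-↭ e (complete F (presf _ q)))
    ... | inj₁ m with y , y∈ , eq ← ∈-map⁻ f m with refl ← injf _ _ q (All.lookup qs y∈) eq = y∈
    ... | inj₂ m with z , z∈ , eq ← ∈-map⁻ g m = ⊥-elim (disj _ _ q (All.lookup rs z∈) eq)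

    completeR : ∀ {z} → R z → z ∈ zs
    completeR r with ∈-++⁻ (map f ys) (Perm.∈-resp-↭ e (complete F (presg _ r)))
    ... | inj₂ m with z , z∈ , eq ← ∈-map⁻ g m with refl ← injg _ _ r (All.lookup rs z∈) eq = z∈
    ... | inj₁ m with y , y∈ , eq ← ∈-map⁻ f m = ⊥-elim (disj _ _ (All.lookup qs y∈) r (sym eq))

opaque
  -- A covering by `f` alone, with the empty predicate on `⊥` as second piece; the enumeration is
  -- pulled back from `Q` to `P`.
  #-bij : (f : A → B) → (∀ x → P x → Q (f x)) → InjectiveOn P f →
          (∀ y → Q y → ∃ λ x → P x × f x ≡ y) → Q # k → P # k
  #-bij {P = P} f pres inj surj F
    with i , j , G , H , eq ← #-split {R = λ (_ : ⊥) → ⊥} f ⊥-elim (λ y → inj₁ ∘ surj y) pres (λ ()) inj (λ ()) (λ _ ()) F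
    with elems H | size H
  ... | [] | refl = subst (P #_) (sym (trans eq (+-identityʳ i))) G

-- Uses no order on A: x and σ x are removed from the list together.
involution-even : (σ : A → A) (n : ℕ) (xs : List A) → length xs ≤ n → Unique xs →
  (∀ {x} → x ∈ xs → σ x ∈ xs) → (∀ {x} → x ∈ xs → σ (σ x) ≡ x) → (∀ {x} → x ∈ xs → σ x ≢ x) →
  ∃ λ m → length xs ≡ 2 * m
involution-even σ _       []       _         _          _      _     _     = 0 , refl
involution-even σ (suc n) (x ∷ xs) (s≤s len) (x∉ AllPairs.∷ uxs) closed invol nofix
  with closed (here refl)
... | here σx≡x = ⊥-elim (nofix (here refl) σx≡x)
... | there σx∈ with ys , zs , refl ← ∈-∃++ σx∈ =
  suc (proj₁ rec) , trans (cong suc lenxs) (trans (cong (suc ∘ suc) (proj₂ rec)) (cong suc (sym (+-suc _ _))))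
  where
  perm : xs ↭ σ x ∷ ys ++ zs
  perm = Perm.shift (σ x) ys zs
  lenxs = Perm.↭-length perm
  u = Unique-resp-↭ perm uxs

  back : ∀ {y} → y ∈ ys ++ zs → y ∈ xs
  back y∈ = Perm.∈-resp-↭ (↭-sym perm) (there y∈)

  closed′ : ∀ {y} → y ∈ ys ++ zs → σ y ∈ ys ++ zs
  closed′ {y} y∈ with closed (there (back y∈))
  -- `σ y ≡ x` would make y equal to `σ x`, which has been removed.
  ... | here σy≡x = ⊥-elim (Uniqueₚ.Unique[x∷xs]⇒x∉xs u
          (subst (_∈ ys ++ zs) (trans (sym (invol (there (back y∈)))) (cong σ σy≡x)) y∈))
  ... | there σy∈ with Perm.∈-resp-↭ perm σy∈
  ...   | there r = r
  ...   | here σy≡σx = ⊥-elim (All.lookup x∉ (back y∈)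
            (trans (sym (invol (here refl))) (trans (cong σ (sym σy≡σx)) (invol (there (back y∈))))))

  rec = involution-even σ n (ys ++ zs)
          (≤-trans (n≤1+n _) (subst (_≤ n) lenxs len)) (AllPairs.tail u)
          closed′ (invol ∘ there ∘ back) (nofix ∘ there ∘ back)

opaque
  #-even : (σ : A → A) → (∀ x → P x → P (σ x)) → (∀ x → σ (σ x) ≡ x) → (∀ x → P x → σ x ≢ x) →
           P # k → ∃ λ m → k ≡ 2 * m
  #-even σ pres invol nofix F
    with m , eq ← involution-even σ _ (elems F) ≤-refl (unique F) (complete F ∘ pres _ ∘ sound F)
                    (λ _ → invol _) (nofix _ ∘ sound F) = m , trans (sym (size F)) eq

opaque
  #-fixed : DecidableEquality A → (σ : A → A) → P # k →
            ∃₂ λ i j → (λ x → P x × σ x ≡ x) # i × (λ x → P x × σ x ≢ x) # j × k ≡ i + j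
  #-fixed {P = P} _≟A_ σ =
    #-split id id cover (λ _ → proj₁) (λ _ → proj₁) (λ _ _ _ _ → id) (λ _ _ _ _ → id)
      (λ { _ _ (_ , e) (_ , ne) refl → ne e })
    where
    cover : ∀ x → P x → (∃ λ y → (P y × σ y ≡ y) × y ≡ x) ⊎ (∃ λ z → (P z × σ z ≢ z) × z ≡ x)
    cover x p with σ x ≟A x
    ... | yes e = inj₁ (x , (p , e) , refl)
    ... | no ne = inj₂ (x , (p , ne) , refl)

opaque
  #-involution : DecidableEquality A → (σ : A → A) → (∀ x → P x → P (σ x)) → (∀ x → σ (σ x) ≡ x) →
                 P # k → ∃₂ λ i m → (λ x → P x × σ x ≡ x) # i × k ≡ i + 2 * m
  #-involution _≟A_ σ pres invol F
    with i , j , G , H , eq ← #-fixed _≟A_ σ F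
    with m , eq′ ← #-even σ (λ x (p , ne) → pres x p , λ e → ne (trans (sym e) (invol x)))
                     invol (λ _ → proj₂) H =
    i , m , G , trans eq (cong (i +_) eq′)

-- Residues

data EvenOdd : ℕ → Set where
  even : ∀ h → EvenOdd (2 * h)
  odd  : ∀ h → EvenOdd (1 + 2 * h)

evenOdd : ∀ n → EvenOdd n
evenOdd zero = even 0
evenOdd (suc n) with evenOdd n
... | even h = odd h
... | odd h  = subst EvenOdd (*-suc 2 h) (even (suc h))

isEven-even : ∀ h → n ≡ 2 * h → isEven n ≡ true
isEven-even zero    refl = refl
isEven-even (suc h) refl rewrite +-suc h (h + 0) = isEven-even h refl

isEven-odd : ∀ h → n ≡ 1 + 2 * h → isEven n ≡ false
isEven-odd zero    refl = refl
isEven-odd (suc h) refl rewrite +-suc h (h + 0) = isEven-odd h refl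

residue-≢ : ∀ d .{{_ : NonZero d}} r r′ x y → r % d ≢ r′ % d → r + x * d ≢ r′ + y * d
residue-≢ d r r′ x y ne eq =
  ne (trans (sym ([m+kn]%n≡m%n r x d)) (trans (cong (_% d) eq) ([m+kn]%n≡m%n r′ y d)))

-- The known equation comes first, so that both of its sides are fixed when the ring solver is
-- called for the other two.
convert : ∀ {a b c d : ℕ} → b ≡ c → a ≡ b → c ≡ d → a ≡ d
convert q p r = trans p (trans q r)

-- Serves to show (2p + 1)² = 1 + 4p(p + 1) ≡ 1 (mod 8).
pronic-even : ∀ p → ∃ λ t → p * suc p ≡ 2 * t
pronic-even p with evenOdd p
... | even h = h * suc (2 * h) , *-assoc 2 h _
... | odd h  = (1 + 2 * h) * suc h , solve (h ∷ [])

x²+y²≢4k+3 : ∀ x y k → x * x + y * y ≢ 4 * k + 3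
x²+y²≢4k+3 x y k eq with evenOdd x | evenOdd y
... | even p | even q =
        residue-≢ 4 0 3 (p * p + q * q) k (λ ())
        (convert eq (solve (p ∷ q ∷ [])) (solve (k ∷ [])))
... | even p | odd q =
        residue-≢ 4 1 3 (p * p + q * q + q) k (λ ())
        (convert eq (solve (p ∷ q ∷ [])) (solve (k ∷ [])))
... | odd p  | even q =
        residue-≢ 4 1 3 (p * p + q * q + p) k (λ ())
        (convert eq (solve (p ∷ q ∷ [])) (solve (k ∷ [])))
... | odd p  | odd q =
        residue-≢ 4 2 3 (p * p + q * q + p + q) k (λ ())
        (convert eq (solve (p ∷ q ∷ [])) (solve (k ∷ [])))

-- Modulo 4 only two odd squares could add up to 8k+6, and their sum is 2 modulo 8.
x²+y²≢2⟨4k+3⟩ : ∀ x y k → x * x + y * y ≢ 2 * (4 * k + 3)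
x²+y²≢2⟨4k+3⟩ x y k eq with evenOdd x | evenOdd y
... | even p | even q =
        residue-≢ 4 0 6 (p * p + q * q) (2 * k) (λ ())
        (convert eq (solve (p ∷ q ∷ [])) (solve (k ∷ [])))
... | even p | odd q =
        residue-≢ 4 1 6 (p * p + q * q + q) (2 * k) (λ ())
        (convert eq (solve (p ∷ q ∷ [])) (solve (k ∷ [])))
... | odd p  | even q =
        residue-≢ 4 1 6 (p * p + q * q + p) (2 * k) (λ ())
        (convert eq (solve (p ∷ q ∷ [])) (solve (k ∷ [])))
... | odd p  | odd q with t , et ← pronic-even p | u , eu ← pronic-even q =
        residue-≢ 8 2 6 (t + u) k (λ ())
        (convert eq
          (convert (cong₂ (λ v w → 2 + (4 * v + 4 * w)) (sym et) (sym eu)) (solve (t ∷ u ∷ [])) (solve (p ∷ q ∷ [])))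
          (solve (k ∷ [])))

-- As in `convert`, the hypothesis comes first; the solver then has to identify the two left sides.
rebase : ∀ {a b c : ℕ} → b ≡ c → a ≡ b → a ≡ c
rebase p q = trans q p

-- The equations whose solutions are counted

ℕ² ℕ³ ℕ⁴ : Set
ℕ² = ℕ × ℕ
ℕ³ = ℕ × ℕ × ℕ
ℕ⁴ = ℕ × ℕ × ℕ × ℕ

pair⁻ : ∀ {A B : Set} {a a′ : A} {b b′ : B} → (a , b) ≡ (a′ , b′) → a ≡ a′ × b ≡ b′
pair⁻ refl = refl , refl

quad⁻ : ∀ {a b c d a′ b′ c′ d′ : ℕ} → (a , b , c , d) ≡ (a′ , b′ , c′ , d′) →
        a ≡ a′ × b ≡ b′ × c ≡ c′ × d ≡ d′
quad⁻ refl = refl , refl , refl , refl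

halve-≡ : ∀ {x y} → 2 * x ≡ 2 * y → x ≡ y
halve-≡ = *-cancelˡ-≡ _ _ 2

-- A positive integer x is represented by its predecessor, so it occurs in the equations as suc x;
-- the comments refer to the positive integers.

-- Ordered factorisations, τ(n) in number.
Divisors : ℕ → Pred ℕ² 0ℓ
Divisors n (c , s) = suc c * suc s ≡ n

-- Factorisations whose first factor is ≡ 3 (mod 4).
Divisors₃ : ℕ → Pred ℕ² 0ℓ
Divisors₃ n (e , s) = (4 * e + 3) * suc s ≡ n

-- The test that `isOmegaᵇ` makes on a part t when the smallest part is s.
allowed : ℕ → ℕ → Bool
allowed t s = isEven t ∨ (t <ᵇ 2 * s)

-- a parts of size s and b parts of size t.
TwoSizes : ℕ → Pred ℕ⁴ 0ℓ
TwoSizes n (a , s , b , t) = suc a * suc s + suc b * suc t ≡ n × s < t × allowed (suc t) (suc s) ≡ true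

-- The solutions with t < 2 s, where s = d + r and t = d + 2 r.
Close : ℕ → Pred (ℕ² × ℕ²) 0ℓ
Close n ((a , b) , (d , r)) = (suc a + suc b) * (suc d + suc r) + suc b * suc r ≡ n

-- The solutions with t = 2 (s + v) ≥ 2 s; here v itself is a natural number.
Far : ℕ → Pred ℕ⁴ 0ℓ
Far n (a , b , s , v) = suc a * suc s + 2 * suc b * (suc s + v) ≡ n

-- v = 0 and v > 0 in Far.
Double : ℕ → Pred ℕ³ 0ℓ
Double n (a , b , s) = (suc a + 2 * suc b) * suc s ≡ n

Beyond : ℕ → Pred ℕ⁴ 0ℓ
Beyond n (a , b , s , v) = (suc a + 2 * suc b) * suc s + 2 * suc b * suc v ≡ n

true≢false : true ≢ false
true≢false ()

opaque
  TwoSizes-split : TwoSizes n # k → ∃₂ λ i j → Close n # i × Far n # j × k ≡ i + j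
  TwoSizes-split {n} = #-split f g cover presf presg (λ x y _ _ → injf x y) (λ x y _ _ → injg x y) disj
    where
    f : ℕ² × ℕ² → ℕ⁴
    f ((a , b) , (d , r)) = a , suc (r + d) , b , suc (suc (r + d)) + r

    g : ℕ⁴ → ℕ⁴
    g (a , b , s , v) = a , s , b , suc s + (s + 2 * v)

    farther : ∀ s v → suc (suc s + (s + v)) ≡ 2 * suc s + v
    farther s v = solve (s ∷ v ∷ [])

    closer : ∀ r d → suc (suc (suc (r + d)) + r) + suc d ≡ 2 * suc (suc (r + d))
    closer r d = solve (r ∷ d ∷ [])

    far-odd : ∀ s v → (suc (suc s + (s + v)) <ᵇ 2 * suc s) ≡ false
    far-odd s v with suc (suc s + (s + v)) <ᵇ 2 * suc s in eq
    ... | false = refl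
    ... | true  = ⊥-elim (<-irrefl refl (≤-<-trans (m≤m+n (2 * suc s) v)
                    (subst (_< 2 * suc s) (farther s v) (<ᵇ⇒< _ _ (Equivalence.from T-≡ eq)))))

    cover : ∀ x → TwoSizes n x → (∃ λ y → Close n y × f y ≡ x) ⊎ (∃ λ z → Far n z × g z ≡ x)
    -- Here r + 1 is the difference t - s, so t < 2 s amounts to `r < s`.
    cover (a , s , b , t) (eq , s<t , ok) with r , refl ← m≤n⇒∃[o]m+o≡n s<t with r <? s
    ... | yes r<s with d , refl ← m≤n⇒∃[o]m+o≡n r<s =
      inj₁ (((a , b) , (d , r)) , rebase eq (solve (a ∷ b ∷ d ∷ r ∷ [])) , refl)
    ... | no r≮s with v , refl ← m≤n⇒∃[o]m+o≡n (≮⇒≥ r≮s) with evenOdd v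
    ...   | even h = inj₂ ((a , b , s , h) , rebase eq (solve (a ∷ b ∷ s ∷ h ∷ [])) , refl)
    -- An odd v makes t = 2 s + v odd and not below 2 s, which `allowed` excludes.
    ...   | odd h  = ⊥-elim (true≢false (trans (sym ok) (cong₂ _∨_
                       (isEven-odd (suc s + h) (trans (farther s (1 + 2 * h)) (solve (s ∷ h ∷ []))))
                       (far-odd s (1 + 2 * h)))))

    presf : ∀ y → Close n y → TwoSizes n (f y)
    presf ((a , b) , (d , r)) eq =
      rebase {suc a * suc (suc (r + d)) + suc b * suc (suc (suc (r + d)) + r)} eq (solve (a ∷ b ∷ d ∷ r ∷ [])) , m≤m+n _ r ,
      trans (cong (isEven (suc (suc (suc (r + d)) + r)) ∨_)
              (Equivalence.to T-≡ (<⇒<ᵇ (subst (suc (suc (suc (r + d)) + r) <_) (closer r d) (m<m+n _ z<s)))))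
            (∨-zeroʳ _)

    presg : ∀ z → Far n z → TwoSizes n (g z)
    presg (a , b , s , v) eq =
      rebase {suc a * suc s + suc b * suc (suc s + (s + 2 * v))} eq (solve (a ∷ b ∷ s ∷ v ∷ [])) , s≤s (m≤m+n s _) ,
      cong (_∨ (suc (suc s + (s + 2 * v)) <ᵇ 2 * suc s))
        (isEven-even (suc s + v) (trans (farther s (2 * v)) (solve (s ∷ v ∷ []))))

    injf : ∀ x y → f x ≡ f y → x ≡ y
    injf ((a , b) , (d , r)) ((a′ , b′) , (d′ , r′)) e
      with refl , e₂ , refl , e₄ ← quad⁻ e
      with refl ← +-cancelˡ-≡ (suc (suc (r + d))) r r′ (trans e₄ (cong (λ z → suc z + r′) (sym e₂)))
      with refl ← +-cancelˡ-≡ (suc r) d d′ e₂ = refl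

    injg : ∀ x y → g x ≡ g y → x ≡ y
    injg (a , b , s , v) (a′ , b′ , s′ , v′) e
      with refl , refl , refl , e₄ ← quad⁻ e
      with refl ← halve-≡ {v} {v′} (+-cancelˡ-≡ s _ _ (+-cancelˡ-≡ (suc s) _ _ e₄)) = refl

    disj : ∀ y z → Close n y → Far n z → f y ≢ g z
    disj ((a , b) , (d , r)) (a′ , b′ , s , v) _ _ e
      with refl , refl , refl , e₄ ← quad⁻ e =
      -- Equal values would force `r ≡ suc (r + d) + 2 * v`.
      m+1+n≰m r (≤-trans (m≤m+n _ (2 * v)) (≤-reflexive (trans lem (sym (+-cancelˡ-≡ (suc (suc (r + d))) _ _ e₄)))))
      where
      lem : r + suc d + 2 * v ≡ suc (r + d) + 2 * v
      lem = cong (_+ 2 * v) (+-suc r d)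

-- Solutions with t ≤ 2 s

opaque
  Far-split : Far n # k → ∃₂ λ i j → Double n # i × Beyond n # j × k ≡ i + j
  Far-split {n} = #-split f g cover
    (λ { (a , b , s) eq → rebase {suc a * suc s + 2 * suc b * (suc s + 0)} eq (solve (a ∷ b ∷ s ∷ [])) })
    (λ { (a , b , s , v) eq → rebase {suc a * suc s + 2 * suc b * (suc s + suc v)} eq (solve (a ∷ b ∷ s ∷ v ∷ [])) })
    (λ { _ _ _ _ refl → refl }) (λ { _ _ _ _ refl → refl }) (λ _ _ _ _ ())
    where
    f : ℕ³ → ℕ⁴
    f (a , b , s) = a , b , s , 0

    g : ℕ⁴ → ℕ⁴
    g (a , b , s , v) = a , b , s , suc v

    cover : ∀ x → Far n x → (∃ λ y → Double n y × f y ≡ x) ⊎ (∃ λ z → Beyond n z × g z ≡ x)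
    cover (a , b , s , zero)  eq = inj₁ ((a , b , s) , rebase eq (solve (a ∷ b ∷ s ∷ [])) , refl)
    cover (a , b , s , suc v) eq = inj₂ ((a , b , s , v) , rebase eq (solve (a ∷ b ∷ s ∷ v ∷ [])) , refl)

opaque
  Close-even : (∀ x y → x * x + y * y ≢ n) → Close n # k → ∃ λ m → k ≡ 2 * m
  Close-even {n} noSquares = #-even swap pres (λ _ → refl) nofix
    where
    pres : ∀ x → Close n x → Close n (swap x)
    pres ((a , b) , (d , r)) eq =
      rebase {(suc d + suc r) * (suc a + suc b) + suc r * suc b} eq (solve (a ∷ b ∷ d ∷ r ∷ []))

    nofix : ∀ x → Close n x → swap x ≢ x
    -- At a fixed point d = a and r = b, so that n = (a + b)² + b².
    nofix ((a , b) , _) eq refl = noSquares (suc a + suc b) (suc b) eq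

2*x≢4k+3 : ∀ x k → 2 * x ≢ 4 * k + 3
2*x≢4k+3 x k eq = even≢odd x (2 * k + 1) (trans eq (solve (k ∷ [])))

4*x≢2⟨4k+3⟩ : ∀ x k → 4 * x ≢ 2 * (4 * k + 3)
4*x≢2⟨4k+3⟩ x k eq = 2*x≢4k+3 x k (halve-≡ (trans (sym (*-assoc 2 2 x)) eq))

odd*odd≢2*x : ∀ p q x → (1 + 2 * p) * (1 + 2 * q) ≢ 2 * x
odd*odd≢2*x p q x eq = even≢odd x (p + q + 2 * p * q) (trans (sym eq) (solve (p ∷ q ∷ [])))

-- `Double` for a = 2 e + 1 and for a even. In both forms the equation depends on the first two
-- coordinates only through their sum, so they may be exchanged.
OddDouble EvenDouble : ℕ → Pred (ℕ² × ℕ) 0ℓ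
OddDouble n ((e , b) , s) = (2 * (e + b) + 3) * suc s ≡ n
EvenDouble n ((a , b) , s) = 2 * (suc a + suc b) * suc s ≡ n

swap₁ : ℕ² × ℕ → ℕ² × ℕ
swap₁ ((a , b) , s) = (b , a) , s

_≟³_ : DecidableEquality (ℕ² × ℕ)
_≟³_ = ≡-dec (≡-dec _≟_ _≟_) _≟_

opaque
  Double-split : Double n # k → ∃₂ λ i j → OddDouble n # i × EvenDouble n # j × k ≡ i + j
  Double-split {n} = #-split f g cover
    (λ { ((e , b) , s) eq → rebase {(suc (2 * e) + 2 * suc b) * suc s} eq (solve (e ∷ b ∷ s ∷ [])) })
    (λ { ((a , b) , s) eq → rebase {(suc (1 + 2 * a) + 2 * suc b) * suc s} eq (solve (a ∷ b ∷ s ∷ [])) })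
    injf injg disj
    where
    f g : ℕ² × ℕ → ℕ³
    f ((e , b) , s) = 2 * e , b , s
    g ((a , b) , s) = 1 + 2 * a , b , s

    cover : ∀ x → Double n x → (∃ λ y → OddDouble n y × f y ≡ x) ⊎ (∃ λ z → EvenDouble n z × g z ≡ x)
    cover (a , b , s) eq with evenOdd a
    ... | even e = inj₁ (((e , b) , s) , rebase eq (solve (e ∷ b ∷ s ∷ [])) , refl)
    ... | odd a′ = inj₂ (((a′ , b) , s) , rebase eq (solve (a′ ∷ b ∷ s ∷ [])) , refl)

    injf : InjectiveOn (OddDouble n) f
    injf ((e , b) , s) ((e′ , b′) , s′) _ _ eq with p , q ← pair⁻ eq with refl ← q | refl ← halve-≡ {e} {e′} p = refl

    injg : InjectiveOn (EvenDouble n) g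
    injg ((a , b) , s) ((a′ , b′) , s′) _ _ eq with p , q ← pair⁻ eq
      with refl ← q | refl ← halve-≡ {a} {a′} (suc-injective p) = refl

    disj : ∀ y z → OddDouble n y → EvenDouble n z → f y ≢ g z
    disj ((e , _) , _) ((a , _) , _) _ _ eq = even≢odd e a (proj₁ (pair⁻ eq))

opaque
  EvenDouble-even : (∀ x → 4 * x ≢ n) → EvenDouble n # k → ∃ λ m → k ≡ 2 * m
  EvenDouble-even {n} 4∤n = #-even swap₁ pres (λ _ → refl) nofix
    where
    pres : ∀ x → EvenDouble n x → EvenDouble n (swap₁ x)
    pres ((a , b) , s) eq = trans (cong (λ z → 2 * z * suc s) (+-comm (suc b) (suc a))) eq

    nofix : ∀ x → EvenDouble n x → swap₁ x ≢ x
    -- A fixed point gives n = 4 a s.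
    nofix ((a , .a) , s) eq refl = 4∤n (suc a * suc s) (rebase eq (solve (a ∷ s ∷ [])))

OddDouble-swap : ∀ x → OddDouble n x → OddDouble n (swap₁ x)
OddDouble-swap ((e , b) , s) eq = trans (cong (λ z → (2 * z + 3) * suc s) (+-comm b e)) eq

opaque
  -- The fixed points of the exchange have e = b, which turns the first factor into 4 e + 3.
  OddDouble-mod2 : OddDouble n # k → ∃₂ λ j m → Divisors₃ n # j × k ≡ j + 2 * m
  OddDouble-mod2 {n} F
    with j , m , G , eq ← #-involution _≟³_ swap₁ OddDouble-swap (λ _ → refl) F =
    j , m , #-bij f presf (λ { _ _ _ _ refl → refl }) surj G , eq
    where
    f : ℕ² → ℕ² × ℕ
    f (e , s) = (e , e) , s

    presf : ∀ x → Divisors₃ n x → OddDouble n (f x) × swap₁ (f x) ≡ f x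
    presf (e , s) eq = rebase {(2 * (e + e) + 3) * suc s} eq (solve (e ∷ s ∷ [])) , refl

    surj : ∀ y → OddDouble n y × swap₁ y ≡ y → ∃ λ x → Divisors₃ n x × f x ≡ y
    surj ((e , .e) , s) (eq , refl) = (e , s) , rebase eq (solve (e ∷ s ∷ [])) , refl

opaque
  Double-mod2 : (∀ x → 4 * x ≢ n) → Double n # k → ∃₂ λ j m → Divisors₃ n # j × k ≡ j + 2 * m
  Double-mod2 4∤n F
    with i , j , G , H , refl ← Double-split F
    with d , m , D , refl ← OddDouble-mod2 G | m′ , refl ← EvenDouble-even 4∤n H =
    d , m + m′ , D , trans (+-assoc d _ _) (cong (d +_) (sym (*-distribˡ-+ 2 m m′)))

-- Factorisations of 4k+3 and of 2(4k+3)

opaque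
  -- Exactly one of the two factors is ≡ 3 (mod 4): both are odd, and two factors in the same class
  -- have a product ≡ 1.
  Divisors-4k+3-split : ∀ k → Divisors (4 * k + 3) # n →
    ∃₂ λ i j → Divisors₃ (4 * k + 3) # i × Divisors₃ (4 * k + 3) # j × n ≡ i + j
  Divisors-4k+3-split k = #-split f g cover presf presg injf injg disj
    where
    f g : ℕ² → ℕ²
    f (e , s) = 2 + 4 * e , s
    g (e , s) = s , 2 + 4 * e

    presf : ∀ y → Divisors₃ (4 * k + 3) y → Divisors (4 * k + 3) (f y)
    presf (e , s) eq = trans (cong (_* suc s) (+-comm 3 (4 * e))) eq

    presg : ∀ y → Divisors₃ (4 * k + 3) y → Divisors (4 * k + 3) (g y)
    presg (e , s) eq = trans (*-comm (suc s) (3 + 4 * e)) (presf (e , s) eq)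

    injf : InjectiveOn (Divisors₃ (4 * k + 3)) f
    injf (e , s) (e′ , s′) _ _ eq with p , q ← pair⁻ eq
      with refl ← q | refl ← *-cancelˡ-≡ e e′ 4 (+-cancelˡ-≡ 2 _ _ p) = refl

    injg : InjectiveOn (Divisors₃ (4 * k + 3)) g
    injg x y p q eq = injf x y p q (cong swap eq)

    disj : ∀ y z → Divisors₃ (4 * k + 3) y → Divisors₃ (4 * k + 3) z → f y ≢ g z
    disj (e , s) (e′ , s′) p _ eq with refl , refl ← pair⁻ eq =
          residue-≢ 4 1 3 (4 * e * e′ + 3 * e + 3 * e′ + 2) k (λ ())
        (convert p (solve (e ∷ e′ ∷ [])) (solve (k ∷ [])))

    four : ∀ e → 2 + 4 * e ≡ 2 * (1 + 2 * e)
    four e = solve (e ∷ [])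

    cover : ∀ x → Divisors (4 * k + 3) x →
            (∃ λ y → Divisors₃ (4 * k + 3) y × f y ≡ x) ⊎ (∃ λ z → Divisors₃ (4 * k + 3) z × g z ≡ x)
    cover (c , s) eq with evenOdd c | evenOdd s
    ... | odd h  | _      = ⊥-elim (2*x≢4k+3 (suc h * suc s) k (rebase eq (solve (h ∷ s ∷ []))))
    ... | even p | odd h  = ⊥-elim (2*x≢4k+3 (suc (2 * p) * suc h) k (rebase eq (solve (p ∷ h ∷ []))))
    ... | even p | even q with evenOdd p | evenOdd q
    ...   | odd e  | _      =
      inj₁ ((e , 2 * q) , rebase eq (solve (e ∷ q ∷ [])) , cong (_, 2 * q) (four e))
    ...   | even t | odd e  =
      inj₂ ((e , 2 * (2 * t)) , rebase eq (solve (e ∷ t ∷ [])) , cong (2 * (2 * t) ,_) (four e))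
    ...   | even t | even u =
          ⊥-elim (residue-≢ 4 1 3 (t + u + 4 * t * u) k (λ ())
              (convert eq (solve (t ∷ u ∷ [])) (solve (k ∷ []))))

-- A splitting into two copies of one predicate supplies two counts, which agree because
-- cardinalities are unique.
#-twice : (∃₂ λ i j → P # i × P # j × n ≡ i + j) → ∃ λ j → P # j × n ≡ 2 * j
#-twice (i , j , G , H , eq) with refl ← #-unique G H = i , G , trans eq (cong (i +_) (sym (+-identityʳ i)))

opaque
  Divisors-4k+3 : ∀ k → Divisors (4 * k + 3) # n → ∃ λ j → Divisors₃ (4 * k + 3) # j × n ≡ 2 * j
  Divisors-4k+3 k = #-twice ∘ Divisors-4k+3-split k

opaque
  -- As 4k+3 is odd, exactly one of the two factors is even; halving it leaves a factorisation of
  -- 4k+3.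
  Divisors-2⟨4k+3⟩ : ∀ k → Divisors (2 * (4 * k + 3)) # n → ∃ λ j → Divisors (4 * k + 3) # j × n ≡ 2 * j
  Divisors-2⟨4k+3⟩ k = #-twice ∘ #-split f g cover presf presg injf injg disj
    where
    m : ℕ
    m = 4 * k + 3

    f g : ℕ² → ℕ²
    f (c , s) = 1 + 2 * c , s
    g (c , s) = c , 1 + 2 * s

    presf : ∀ y → Divisors m y → Divisors (2 * m) (f y)
    presf (c , s) eq = rebase {suc (1 + 2 * c) * suc s} (cong (2 *_) eq) (solve (c ∷ s ∷ []))

    presg : ∀ y → Divisors m y → Divisors (2 * m) (g y)
    presg (c , s) eq = rebase {suc c * suc (1 + 2 * s)} (cong (2 *_) eq) (solve (c ∷ s ∷ []))

    injf : InjectiveOn (Divisors m) f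
    injf (c , s) (c′ , s′) _ _ eq with p , q ← pair⁻ eq
      with refl ← q | refl ← halve-≡ {c} {c′} (suc-injective p) = refl

    injg : InjectiveOn (Divisors m) g
    injg (c , s) (c′ , s′) _ _ eq with p , q ← pair⁻ eq
      with refl ← p | refl ← halve-≡ {s} {s′} (suc-injective q) = refl

    disj : ∀ y z → Divisors m y → Divisors m z → f y ≢ g z
    disj (c , s) (c′ , s′) p _ eq with refl , refl ← pair⁻ eq =
      2*x≢4k+3 (suc c * suc s′) k (rebase p (solve (c ∷ s′ ∷ [])))

    cover : ∀ x → Divisors (2 * m) x → (∃ λ y → Divisors m y × f y ≡ x) ⊎ (∃ λ z → Divisors m z × g z ≡ x)
    cover (c , s) eq with evenOdd c | evenOdd s
    ... | odd h  | _      = inj₁ ((h , s) , halve-≡ (rebase eq (solve (h ∷ s ∷ []))) , refl)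
    ... | even p | odd h  = inj₂ ((2 * p , h) , halve-≡ (rebase eq (solve (p ∷ h ∷ []))) , refl)
    ... | even p | even q = ⊥-elim (odd*odd≢2*x p q m eq)

opaque
  -- The factor 4 e + 3 is odd, so the prime 2 divides the cofactor.
  Divisors₃-2⟨4k+3⟩ : ∀ k → Divisors₃ (2 * (4 * k + 3)) # n → Divisors₃ (4 * k + 3) # n
  Divisors₃-2⟨4k+3⟩ k = #-bij f presf injf surj
    where
    m : ℕ
    m = 4 * k + 3

    f : ℕ² → ℕ²
    f (e , s) = e , 1 + 2 * s

    presf : ∀ x → Divisors₃ m x → Divisors₃ (2 * m) (f x)
    presf (e , s) eq = rebase {(4 * e + 3) * suc (1 + 2 * s)} (cong (2 *_) eq) (solve (e ∷ s ∷ []))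

    injf : InjectiveOn (Divisors₃ m) f
    injf (e , s) (e′ , s′) _ _ eq with p , q ← pair⁻ eq
      with refl ← p | refl ← halve-≡ {s} {s′} (suc-injective q) = refl

    surj : ∀ y → Divisors₃ (2 * m) y → ∃ λ x → Divisors₃ m x × f x ≡ y
    surj (e , s) eq with evenOdd s
    ... | odd h  = (e , h) , halve-≡ (rebase eq (solve (e ∷ h ∷ []))) , refl
    ... | even q = ⊥-elim (odd*odd≢2*x (2 * e + 1) q m (rebase eq (solve (e ∷ q ∷ []))))

-- Solutions with t > 2 s

opaque
  #-bounded : {P : Pred ℕ⁴ 0ℓ} → Decidable P → ∀ n →
              (∀ a b c d → P (a , b , c , d) → a < n × b < n × c < n × d < n) → ∃ λ k → P # k
  #-bounded {P} P? n bound = _ , record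
    { elems = filter P? box ; size = refl
    ; unique = Uniqueₚ.filter⁺ P? (Uniqueₚ.cartesianProduct⁺ u (Uniqueₚ.cartesianProduct⁺ u (Uniqueₚ.cartesianProduct⁺ u u)))
    ; sound = λ x∈ → proj₂ (∈-filter⁻ P? {xs = box} x∈)
    ; complete = λ {x} p → ∈-filter⁺ P? (inBox x (bound _ _ _ _ p)) p }
    where
    ns : List ℕ
    ns = upTo n

    u : Unique ns
    u = Uniqueₚ.upTo⁺ n

    box : List ℕ⁴
    box = cartesianProduct ns (cartesianProduct ns (cartesianProduct ns ns))

    inBox : ∀ x → proj₁ x < n × proj₁ (proj₂ x) < n × proj₁ (proj₂ (proj₂ x)) < n × proj₂ (proj₂ (proj₂ x)) < n → x ∈ box
    inBox _ (p , q , r , t) = ∈-cartesianProduct⁺ (∈-upTo⁺ p)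
      (∈-cartesianProduct⁺ (∈-upTo⁺ q) (∈-cartesianProduct⁺ (∈-upTo⁺ r) (∈-upTo⁺ t)))

-- Solutions with t > 2 s for n = 4k+3

Total TotalOdd : ℕ → Pred ℕ⁴ 0ℓ
Total n (a , s , b , v) = suc a * suc s + 2 * (suc b * suc v) ≡ n
TotalOdd n (a , s , z , w) = suc a * suc s + 2 * ((1 + 2 * z) * suc w) ≡ n

-- `Total` with b = 2 z; the pairing gives each product its own exchange of factors.
TotalEven : ℕ → Pred (ℕ² × ℕ²) 0ℓ
TotalEven n ((a , s) , (z , w)) = suc a * suc s + 4 * (suc z * suc w) ≡ n

-- The solutions of Total with a < 2 b, where a = 2 x + 1 and 2 b - a = 2 y + 1; they are split by the parity of v.
Within WithinEven WithinOdd : ℕ → Pred ℕ⁴ 0ℓ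
Within n (x , y , s , v) = (1 + 2 * x) * (suc s + suc v) + (1 + 2 * y) * suc v ≡ n
WithinEven n (x , y , i , j) = (1 + 2 * x) * (2 * suc (i + j)) + (1 + 2 * y) * (1 + 2 * i) ≡ n
WithinOdd n (x , y , i , j) = (1 + 2 * x) * (2 * (i + j) + 3) + (1 + 2 * y) * (2 * suc i) ≡ n

opaque
  -- `Total` also has solutions with a < 2 b, which `TwoSizes` does not provide, so its finiteness
  -- is proved by a search below `n`.
  Total-finite : ∀ n → ∃ λ k → Total n # k
  Total-finite n = #-bounded (λ _ → _ ≟ n) n bound
    where
    bound : ∀ a s b v → Total n (a , s , b , v) → a < n × s < n × b < n × v < n
    bound a s b v refl =
      ≤-trans (m≤m*n (suc a) (suc s)) as , ≤-trans (m≤n*m (suc s) (suc a)) as ,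
      ≤-trans (m≤m*n (suc b) (suc v)) bv , ≤-trans (m≤n*m (suc v) (suc b)) bv
      where
      as : suc a * suc s ≤ suc a * suc s + 2 * (suc b * suc v)
      as = m≤m+n _ _
      bv : suc b * suc v ≤ suc a * suc s + 2 * (suc b * suc v)
      bv = ≤-trans (m≤n*m (suc b * suc v) 2) (m≤n+m (2 * (suc b * suc v)) (suc a * suc s))

opaque
  -- As 4k+3 is odd, a is odd and differs from 2 b; the two pieces are a > 2 b and a < 2 b.
  Total-compare : ∀ k → Total (4 * k + 3) # n →
    ∃₂ λ i j → Beyond (4 * k + 3) # i × Within (4 * k + 3) # j × n ≡ i + j
  Total-compare k = #-split f g cover presf presg injf injg disj
    where
    m : ℕ
    m = 4 * k + 3

    f g : ℕ⁴ → ℕ⁴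
    f (a , b , s , v) = 2 * suc b + a , s , b , v
    g (x , y , s , v) = 2 * x , s , x + y , v

    presf : ∀ y → Beyond m y → Total m (f y)
    presf (a , b , s , v) eq =
      rebase {suc (2 * suc b + a) * suc s + 2 * (suc b * suc v)} eq (solve (a ∷ b ∷ s ∷ v ∷ []))

    presg : ∀ y → Within m y → Total m (g y)
    presg (x , y , s , v) eq =
      rebase {suc (2 * x) * suc s + 2 * (suc (x + y) * suc v)} eq (solve (x ∷ y ∷ s ∷ v ∷ []))

    injf : InjectiveOn (Beyond m) f
    injf (a , b , s , v) (a′ , b′ , s′ , v′) _ _ eq with p , refl , refl , refl ← quad⁻ eq
      with refl ← +-cancelˡ-≡ (2 * suc b) a a′ p = refl

    injg : InjectiveOn (Within m) g
    injg (x , y , s , v) (x′ , y′ , s′ , v′) _ _ eq with p , refl , q , refl ← quad⁻ eq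
      with refl ← halve-≡ {x} {x′} p with refl ← +-cancelˡ-≡ x y y′ q = refl

    disj : ∀ y z → Beyond m y → Within m z → f y ≢ g z
    disj (a , b , s , v) (x , y , s′ , v′) _ _ eq with p , _ , refl , _ ← quad⁻ eq =
      <-irrefl (sym p) (<-≤-trans (*-monoʳ-< 2 (s≤s (m≤m+n x y))) (m≤m+n _ a))

    cover : ∀ x → Total m x → (∃ λ y → Beyond m y × f y ≡ x) ⊎ (∃ λ z → Within m z × g z ≡ x)
    cover (a , s , b , v) eq with evenOdd a
    ... | odd h = ⊥-elim (2*x≢4k+3 (suc h * suc s + suc b * suc v) k (rebase eq (solve (h ∷ s ∷ b ∷ v ∷ []))))
    ... | even x with x ≤? b
    ...   | yes x≤b with y , refl ← m≤n⇒∃[o]m+o≡n x≤b =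
      inj₂ ((x , y , s , v) , rebase eq (solve (x ∷ y ∷ s ∷ v ∷ [])) , refl)
    ...   | no x≰b with a′ , refl ← m≤n⇒∃[o]m+o≡n (≰⇒> x≰b) =
      inj₁ ((2 * a′ , b , s , v) , rebase eq (solve (a′ ∷ b ∷ s ∷ v ∷ [])) ,
            cong (_, s , b , v) (sym (*-distribˡ-+ 2 (suc b) a′)))

opaque
  Total-parity : Total n # k → ∃₂ λ i j → TotalOdd n # i × TotalEven n # j × k ≡ i + j
  Total-parity {n} = #-split f g cover (λ _ → id) presg injf injg disj
    where
    f : ℕ⁴ → ℕ⁴
    f (a , s , z , w) = a , s , 2 * z , w

    g : ℕ² × ℕ² → ℕ⁴
    g ((a , s) , (z , w)) = a , s , 1 + 2 * z , w

    presg : ∀ y → TotalEven n y → Total n (g y)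
    presg ((a , s) , (z , w)) eq =
      rebase {suc a * suc s + 2 * (suc (1 + 2 * z) * suc w)} eq (solve (a ∷ s ∷ z ∷ w ∷ []))

    injf : InjectiveOn (TotalOdd n) f
    injf (a , s , z , w) (a′ , s′ , z′ , w′) _ _ eq with refl , refl , p , refl ← quad⁻ eq
      with refl ← halve-≡ {z} {z′} p = refl

    injg : InjectiveOn (TotalEven n) g
    injg ((a , s) , (z , w)) ((a′ , s′) , (z′ , w′)) _ _ eq with refl , refl , p , refl ← quad⁻ eq
      with refl ← halve-≡ {z} {z′} (suc-injective p) = refl

    disj : ∀ y z → TotalOdd n y → TotalEven n z → f y ≢ g z
    disj (_ , _ , z , _) (_ , (z′ , _)) _ _ eq = even≢odd z z′ (proj₁ (proj₂ (proj₂ (quad⁻ eq))))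

    cover : ∀ x → Total n x → (∃ λ y → TotalOdd n y × f y ≡ x) ⊎ (∃ λ z → TotalEven n z × g z ≡ x)
    cover (a , s , b , w) eq with evenOdd b
    ... | even z = inj₁ ((a , s , z , w) , eq , refl)
    ... | odd z  = inj₂ (((a , s) , (z , w)) , rebase eq (solve (a ∷ s ∷ z ∷ w ∷ [])) , refl)

opaque
  -- Modulo 2 the left side of `Within` is s, so s is odd and exactly one of v and s + v is even.
  Within-parity : ∀ k → Within (4 * k + 3) # n →
    ∃₂ λ i j → WithinEven (4 * k + 3) # i × WithinOdd (4 * k + 3) # j × n ≡ i + j
  Within-parity k = #-split f g cover presf presg injf injg disj
    where
    m : ℕ
    m = 4 * k + 3

    f g : ℕ⁴ → ℕ⁴
    f (x , y , i , j) = x , y , 2 * j , 2 * i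
    g (x , y , i , j) = x , y , 2 * j , 1 + 2 * i

    presf : ∀ y → WithinEven m y → Within m (f y)
    presf (x , y , i , j) eq =
      rebase {(1 + 2 * x) * (suc (2 * j) + suc (2 * i)) + (1 + 2 * y) * suc (2 * i)} eq (solve (x ∷ y ∷ i ∷ j ∷ []))

    presg : ∀ y → WithinOdd m y → Within m (g y)
    presg (x , y , i , j) eq =
      rebase {(1 + 2 * x) * (suc (2 * j) + suc (1 + 2 * i)) + (1 + 2 * y) * suc (1 + 2 * i)} eq
        (solve (x ∷ y ∷ i ∷ j ∷ []))

    injf : InjectiveOn (WithinEven m) f
    injf (x , y , i , j) (x′ , y′ , i′ , j′) _ _ eq with refl , refl , p , q ← quad⁻ eq
      with refl ← halve-≡ {j} {j′} p | refl ← halve-≡ {i} {i′} q = refl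

    injg : InjectiveOn (WithinOdd m) g
    injg (x , y , i , j) (x′ , y′ , i′ , j′) _ _ eq with refl , refl , p , q ← quad⁻ eq
      with refl ← halve-≡ {j} {j′} p | refl ← halve-≡ {i} {i′} (suc-injective q) = refl

    disj : ∀ y z → WithinEven m y → WithinOdd m z → f y ≢ g z
    disj (_ , _ , i , _) (_ , _ , i′ , _) _ _ eq = even≢odd i i′ (proj₂ (proj₂ (proj₂ (quad⁻ eq))))

    cover : ∀ x → Within m x → (∃ λ y → WithinEven m y × f y ≡ x) ⊎ (∃ λ z → WithinOdd m z × g z ≡ x)
    cover (x , y , s , v) eq with evenOdd s | evenOdd v
    ... | odd h  | _ = ⊥-elim (2*x≢4k+3 ((1 + 2 * x) * suc h + suc v * (1 + x + y)) k
                         (rebase eq (solve (x ∷ y ∷ h ∷ v ∷ []))))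
    ... | even j | even i = inj₁ ((x , y , i , j) , rebase eq (solve (x ∷ y ∷ i ∷ j ∷ [])) , refl)
    ... | even j | odd i  = inj₂ ((x , y , i , j) , rebase eq (solve (x ∷ y ∷ i ∷ j ∷ [])) , refl)

opaque
  -- The odd and the even one among the factors v and s + v of `Within` become s and 2 w in
  -- `TotalOdd`. The larger of them comes from s + v, so comparing s with 2 w recovers the case.
  TotalOdd-compare : ∀ k → TotalOdd (4 * k + 3) # n →
    ∃₂ λ i j → WithinEven (4 * k + 3) # i × WithinOdd (4 * k + 3) # j × n ≡ i + j
  TotalOdd-compare k = #-split f g cover presf presg injf injg disj
    where
    m : ℕ
    m = 4 * k + 3

    f g : ℕ⁴ → ℕ⁴
    f (x , y , i , j) = 2 * y , 2 * i , x , i + j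
    g (x , y , i , j) = 2 * x , 2 * (suc i + j) , y , i

    presf : ∀ y → WithinEven m y → TotalOdd m (f y)
    presf (x , y , i , j) eq =
      rebase {suc (2 * y) * suc (2 * i) + 2 * ((1 + 2 * x) * suc (i + j))} eq (solve (x ∷ y ∷ i ∷ j ∷ []))

    presg : ∀ y → WithinOdd m y → TotalOdd m (g y)
    presg (x , y , i , j) eq =
      rebase {suc (2 * x) * suc (2 * (suc i + j)) + 2 * ((1 + 2 * y) * suc i)} eq (solve (x ∷ y ∷ i ∷ j ∷ []))

    injf : InjectiveOn (WithinEven m) f
    injf (x , y , i , j) (x′ , y′ , i′ , j′) _ _ eq with p , q , refl , r ← quad⁻ eq
      with refl ← halve-≡ {y} {y′} p | refl ← halve-≡ {i} {i′} q
      with refl ← +-cancelˡ-≡ i j j′ r = refl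

    injg : InjectiveOn (WithinOdd m) g
    injg (x , y , i , j) (x′ , y′ , i′ , j′) _ _ eq with p , q , refl , refl ← quad⁻ eq
      with refl ← halve-≡ {x} {x′} p
      with refl ← +-cancelˡ-≡ (suc i) j j′ (halve-≡ {suc i + j} {suc i + j′} q) = refl

    disj : ∀ y z → WithinEven m y → WithinOdd m z → f y ≢ g z
    disj (x , y , i , j) (x′ , y′ , i′ , j′) _ _ eq with _ , q , _ , refl ← quad⁻ eq =
      <-irrefl (halve-≡ {i} {suc (i + j) + j′} q) (s≤s (≤-trans (m≤m+n i j) (m≤m+n (i + j) j′)))

    cover : ∀ x → TotalOdd m x → (∃ λ y → WithinEven m y × f y ≡ x) ⊎ (∃ λ z → WithinOdd m z × g z ≡ x)
    cover (a , s , z , w) eq with evenOdd a | evenOdd s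
    ... | odd h  | _     = ⊥-elim (2*x≢4k+3 (suc h * suc s + (1 + 2 * z) * suc w) k
                             (rebase eq (solve (h ∷ s ∷ z ∷ w ∷ []))))
    ... | even y | odd h = ⊥-elim (2*x≢4k+3 ((1 + 2 * y) * suc h + (1 + 2 * z) * suc w) k
                             (rebase eq (solve (h ∷ y ∷ z ∷ w ∷ []))))
    -- With s = 2 i + 1, `i ≤ w` says that s is less than twice the positive integer represented by
    -- `w`.
    ... | even y | even i with i ≤? w
    ...   | yes i≤w with j , refl ← m≤n⇒∃[o]m+o≡n i≤w =
      inj₁ ((z , y , i , j) , rebase eq (solve (z ∷ y ∷ i ∷ j ∷ [])) , refl)
    ...   | no i≰w with j , refl ← m≤n⇒∃[o]m+o≡n (≰⇒> i≰w) =
      inj₂ ((y , z , w , j) , rebase eq (solve (z ∷ y ∷ w ∷ j ∷ [])) , refl)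

swapˡ swapʳ : ℕ² × ℕ² → ℕ² × ℕ²
swapˡ (p , q) = swap p , q
swapʳ (p , q) = p , swap q

_≟⁴_ : DecidableEquality (ℕ² × ℕ²)
_≟⁴_ = ≡-dec (≡-dec _≟_ _≟_) (≡-dec _≟_ _≟_)

TotalEven-swapˡ : ∀ x → TotalEven n x → TotalEven n (swapˡ x)
TotalEven-swapˡ ((a , s) , (z , w)) eq = trans (cong (_+ 4 * (suc z * suc w)) (*-comm (suc s) (suc a))) eq

TotalEven-swapʳ : ∀ x → TotalEven n x → TotalEven n (swapʳ x)
TotalEven-swapʳ ((a , s) , (z , w)) eq = trans (cong (λ t → suc a * suc s + 4 * t) (*-comm (suc w) (suc z))) eq

opaque
  TotalEven-fixed-even : (∀ x y → x * x + y * y ≢ n) →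
    (λ x → TotalEven n x × swapˡ x ≡ x) # k → ∃ λ m → k ≡ 2 * m
  TotalEven-fixed-even {n} noSquares = #-even swapʳ pres (λ _ → refl) nofix
    where
    pres : ∀ x → TotalEven n x × swapˡ x ≡ x → TotalEven n (swapʳ x) × swapˡ (swapʳ x) ≡ swapʳ x
    pres x (p , e) = TotalEven-swapʳ x p , cong swapʳ e

    nofix : ∀ x → TotalEven n x × swapˡ x ≡ x → swapʳ x ≢ x
    -- A point fixed by both exchanges gives n = a² + (2 z)².
    nofix ((a , _) , (z , _)) (eq , refl) refl =
      noSquares (suc a) (2 * suc z) (rebase eq (solve (a ∷ z ∷ [])))

opaque
  TotalEven-even : (∀ x y → x * x + y * y ≢ n) → TotalEven n # k → ∃ λ m → k ≡ 2 * m
  TotalEven-even noSquares F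
    with i , m , G , refl ← #-involution _≟⁴_ swapˡ TotalEven-swapˡ (λ _ → refl) F
    with m′ , refl ← TotalEven-fixed-even noSquares G = m′ + m , sym (*-distribˡ-+ 2 m′ m)

opaque
  -- `Total` is counted in two ways, as `Beyond` plus `Within` and as `TotalOdd` plus `TotalEven`.
  -- The equinumerous `Within` and `TotalOdd` cancel.
  Beyond-4k+3 : ∀ k → ∃ λ m → Beyond (4 * k + 3) # (2 * m)
  Beyond-4k+3 k with t , F ← Total-finite (4 * k + 3)
    with i , j , Bey , Wit , refl ← Total-compare k F | i′ , j′ , Odd , Even , eq ← Total-parity F
    with c , d , W₁ , W₂ , refl ← Within-parity k Wit | c′ , d′ , W₁′ , W₂′ , refl ← TotalOdd-compare k Odd
    with refl ← #-unique W₁ W₁′ | refl ← #-unique W₂ W₂′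
    with m , refl ← TotalEven-even (λ x y → x²+y²≢4k+3 x y k) Even
    with refl ← +-cancelʳ-≡ (c + d) i (2 * m) (trans eq (+-comm (c + d) (2 * m))) = m , Bey

-- Solutions with t > 2 s for n = 2(4k+3)

-- Beyond (2 m), split by the parity of a: Nested for a even, Skew for a odd (and hence s even).
Nested : ℕ → Pred (ℕ² × ℕ²) 0ℓ
Nested m ((a , s) , (v , b)) = (suc a + suc b) * suc s + suc b * suc v ≡ m

Skew SkewEven : ℕ → Pred ℕ⁴ 0ℓ
Skew m (x , b , s , v) = (1 + 2 * x + 2 * suc b) * suc s + suc b * suc v ≡ m
SkewEven m (x , b , s , v) = (1 + 2 * x + 2 * suc b) * suc s + 2 * suc b * suc v ≡ m

SkewOdd : ℕ → Pred (ℕ² × ℕ²) 0ℓ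
SkewOdd m ((x , b) , (y , s)) = (1 + 2 * x + 2 * suc b) * suc s + suc b * (1 + 2 * y) ≡ m

-- The factorisations m = c s with c > s, where c - s = 2 a.
DivisorPairs : ℕ → Pred ℕ² 0ℓ
DivisorPairs m (a , s) = (2 * suc a + suc s) * suc s ≡ m

opaque
  Beyond-2⟨4k+3⟩-split : ∀ k → Beyond (2 * (4 * k + 3)) # n →
    ∃₂ λ i j → Nested (4 * k + 3) # i × Skew (4 * k + 3) # j × n ≡ i + j
  Beyond-2⟨4k+3⟩-split k = #-split f g cover presf presg injf injg disj
    where
    m : ℕ
    m = 4 * k + 3

    f : ℕ² × ℕ² → ℕ⁴
    f ((a , s) , (v , b)) = 1 + 2 * a , b , s , v

    g : ℕ⁴ → ℕ⁴
    g (x , b , s , v) = 2 * x , b , 1 + 2 * s , v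

    presf : ∀ y → Nested m y → Beyond (2 * m) (f y)
    presf ((a , s) , (v , b)) eq =
      rebase {(suc (1 + 2 * a) + 2 * suc b) * suc s + 2 * suc b * suc v} (cong (2 *_) eq) (solve (a ∷ s ∷ v ∷ b ∷ []))

    presg : ∀ y → Skew m y → Beyond (2 * m) (g y)
    presg (x , b , s , v) eq =
      rebase {(suc (2 * x) + 2 * suc b) * suc (1 + 2 * s) + 2 * suc b * suc v} (cong (2 *_) eq)
        (solve (x ∷ b ∷ s ∷ v ∷ []))

    injf : InjectiveOn (Nested m) f
    injf ((a , s) , (v , b)) ((a′ , s′) , (v′ , b′)) _ _ eq with p , refl , refl , refl ← quad⁻ eq
      with refl ← halve-≡ {a} {a′} (suc-injective p) = refl

    injg : InjectiveOn (Skew m) g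
    injg (x , b , s , v) (x′ , b′ , s′ , v′) _ _ eq with p , refl , q , refl ← quad⁻ eq
      with refl ← halve-≡ {x} {x′} p | refl ← halve-≡ {s} {s′} (suc-injective q) = refl

    disj : ∀ y z → Nested m y → Skew m z → f y ≢ g z
    disj ((a , _) , _) (x , _) _ _ eq = even≢odd x a (sym (proj₁ (quad⁻ eq)))

    cover : ∀ x → Beyond (2 * m) x → (∃ λ y → Nested m y × f y ≡ x) ⊎ (∃ λ z → Skew m z × g z ≡ x)
    cover (a , b , s , v) eq with evenOdd a | evenOdd s
    ... | odd a′ | _      = inj₁ (((a′ , s) , (v , b)) , halve-≡ (rebase eq (solve (a′ ∷ s ∷ v ∷ b ∷ []))) , refl)
    ... | even x | odd s′ = inj₂ ((x , b , s′ , v) , halve-≡ (rebase eq (solve (x ∷ b ∷ s′ ∷ v ∷ []))) , refl)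
    ... | even x | even q = ⊥-elim (even≢odd m (x + suc b + q + 2 * (x + suc b) * q + suc b * suc v)
                              (sym (rebase eq (solve (x ∷ b ∷ q ∷ v ∷ [])))))

opaque
  Skew-split : Skew n # k → ∃₂ λ i j → SkewEven n # i × SkewOdd n # j × k ≡ i + j
  Skew-split {n} = #-split f g cover presf presg injf injg disj
    where
    f : ℕ⁴ → ℕ⁴
    f (x , b , s , v) = x , b , s , 1 + 2 * v

    g : ℕ² × ℕ² → ℕ⁴
    g ((x , b) , (y , s)) = x , b , s , 2 * y

    presf : ∀ y → SkewEven n y → Skew n (f y)
    presf (x , b , s , v) eq =
      rebase {(1 + 2 * x + 2 * suc b) * suc s + suc b * suc (1 + 2 * v)} eq (solve (x ∷ b ∷ s ∷ v ∷ []))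

    presg : ∀ y → SkewOdd n y → Skew n (g y)
    presg ((x , b) , (y , s)) eq =
      rebase {(1 + 2 * x + 2 * suc b) * suc s + suc b * suc (2 * y)} eq (solve (x ∷ b ∷ s ∷ y ∷ []))

    injf : InjectiveOn (SkewEven n) f
    injf (x , b , s , v) (x′ , b′ , s′ , v′) _ _ eq with refl , refl , refl , p ← quad⁻ eq
      with refl ← halve-≡ {v} {v′} (suc-injective p) = refl

    injg : InjectiveOn (SkewOdd n) g
    injg ((x , b) , (y , s)) ((x′ , b′) , (y′ , s′)) _ _ eq with refl , refl , refl , p ← quad⁻ eq
      with refl ← halve-≡ {y} {y′} p = refl

    disj : ∀ y z → SkewEven n y → SkewOdd n z → f y ≢ g z
    disj (_ , _ , _ , v) (_ , (y , _)) _ _ eq = even≢odd y v (sym (proj₂ (proj₂ (proj₂ (quad⁻ eq)))))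

    cover : ∀ x → Skew n x → (∃ λ y → SkewEven n y × f y ≡ x) ⊎ (∃ λ z → SkewOdd n z × g z ≡ x)
    cover (x , b , s , v) eq with evenOdd v
    ... | odd v′ = inj₁ ((x , b , s , v′) , rebase eq (solve (x ∷ b ∷ s ∷ v′ ∷ [])) , refl)
    ... | even y = inj₂ (((x , b) , (y , s)) , rebase eq (solve (x ∷ b ∷ s ∷ y ∷ [])) , refl)

opaque
  -- For an odd right side, a is odd in `Beyond`; writing a = 2 x + 1 gives `SkewEven`.
  SkewEven-Beyond : ∀ k → Beyond (4 * k + 3) # n → SkewEven (4 * k + 3) # n
  SkewEven-Beyond k = #-bij f (λ _ → id) injf surj
    where
    m : ℕ
    m = 4 * k + 3

    f : ℕ⁴ → ℕ⁴
    f (x , b , s , v) = 2 * x , b , s , v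

    injf : InjectiveOn (SkewEven m) f
    injf (x , b , s , v) (x′ , b′ , s′ , v′) _ _ eq with p , refl , refl , refl ← quad⁻ eq
      with refl ← halve-≡ {x} {x′} p = refl

    surj : ∀ y → Beyond m y → ∃ λ x → SkewEven m x × f x ≡ y
    surj (a , b , s , v) eq with evenOdd a
    ... | even x = (x , b , s , v) , eq , refl
    ... | odd h  = ⊥-elim (2*x≢4k+3 ((suc h + suc b) * suc s + suc b * suc v) k
                     (rebase eq (solve (h ∷ b ∷ s ∷ v ∷ []))))

opaque
  -- Expanded, the equation is (2 x + 1) s + 2 b s + (2 y + 1) b = m, symmetric under (x , b) ↔ (y ,
  -- s); a fixed point would make m even.
  SkewOdd-even : ∀ k → SkewOdd (4 * k + 3) # n → ∃ λ m → n ≡ 2 * m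
  SkewOdd-even k = #-even swap pres (λ _ → refl) nofix
    where
    m : ℕ
    m = 4 * k + 3

    pres : ∀ x → SkewOdd m x → SkewOdd m (swap x)
    pres ((x , b) , (y , s)) eq =
      rebase {(1 + 2 * y + 2 * suc s) * suc b + suc s * (1 + 2 * x)} eq (solve (x ∷ b ∷ y ∷ s ∷ []))

    nofix : ∀ x → SkewOdd m x → swap x ≢ x
    nofix ((x , b) , (.x , .b)) eq refl = 2*x≢4k+3 (suc b * (1 + 2 * x + suc b)) k (rebase eq (solve (x ∷ b ∷ [])))

opaque
  -- Expanded, the equation is a s + b s + b v = n, symmetric under (a , s) ↔ (v , b); at a fixed
  -- point it reads (2 a + s) s = n.
  Nested-mod2 : Nested n # k → ∃₂ λ j m → DivisorPairs n # j × k ≡ j + 2 * m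
  Nested-mod2 {n} F = fromFixed (#-involution _≟⁴_ swap pres (λ _ → refl) F)
    where
    pres : ∀ x → Nested n x → Nested n (swap x)
    pres ((a , s) , (v , b)) eq =
      rebase {(suc v + suc s) * suc b + suc s * suc a} eq (solve (a ∷ s ∷ v ∷ b ∷ []))

    f : ℕ² → ℕ² × ℕ²
    f p = p , p

    presf : ∀ x → DivisorPairs n x → Nested n (f x) × swap (f x) ≡ f x
    presf (a , s) eq = rebase {(suc a + suc s) * suc s + suc s * suc a} eq (solve (a ∷ s ∷ [])) , refl

    surj : ∀ y → Nested n y × swap y ≡ y → ∃ λ x → DivisorPairs n x × f x ≡ y
    surj ((a , s) , (.a , .s)) (eq , refl) = (a , s) , rebase eq (solve (a ∷ s ∷ [])) , refl

    fromFixed : ∀ {k} → (∃₂ λ i m → (λ x → Nested n x × swap x ≡ x) # i × k ≡ i + 2 * m) →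
                ∃₂ λ j m → DivisorPairs n # j × k ≡ j + 2 * m
    fromFixed (j , m , G , eq) = j , m , #-bij f presf (λ { _ _ _ _ refl → refl }) surj G , eq

opaque
  -- The odd number 4k+3 is no square, so its two factors differ, and by an even number; either may
  -- be the larger.
  Divisors-pairs : ∀ k → Divisors (4 * k + 3) # n → ∃ λ j → DivisorPairs (4 * k + 3) # j × n ≡ 2 * j
  Divisors-pairs k = #-twice ∘ #-split f g cover presf presg injf injg disj
    where
    m : ℕ
    m = 4 * k + 3

    f g : ℕ² → ℕ²
    f (a , s) = 2 * suc a + s , s
    g (a , s) = s , 2 * suc a + s

    presf : ∀ y → DivisorPairs m y → Divisors m (f y)
    presf (a , s) eq = trans (cong (_* suc s) (sym (+-suc (2 * suc a) s))) eq

    presg : ∀ y → DivisorPairs m y → Divisors m (g y)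
    presg (a , s) eq = trans (*-comm (suc s) (suc (2 * suc a + s))) (presf (a , s) eq)

    injf : InjectiveOn (DivisorPairs m) f
    injf (a , s) (a′ , s′) _ _ eq with p , q ← pair⁻ eq with refl ← q
      with refl ← halve-≡ {suc a} {suc a′} (+-cancelʳ-≡ s _ _ p) = refl

    injg : InjectiveOn (DivisorPairs m) g
    injg x y p q eq = injf x y p q (cong swap eq)

    disj : ∀ y z → DivisorPairs m y → DivisorPairs m z → f y ≢ g z
    disj (a , s) (a′ , s′) _ _ eq with p , q ← pair⁻ eq =
      <-asym (subst (s <_) p (m<n+m s z<s)) (subst (s′ <_) (sym q) (m<n+m s′ z<s))

    bigger : ∀ p o → 2 * suc o + 2 * p ≡ 2 * (suc p + o)
    bigger p o = solve (p ∷ o ∷ [])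

    cover : ∀ x → Divisors m x → (∃ λ y → DivisorPairs m y × f y ≡ x) ⊎ (∃ λ z → DivisorPairs m z × g z ≡ x)
    cover (c , s) eq with evenOdd c | evenOdd s
    ... | odd h  | _      = ⊥-elim (2*x≢4k+3 (suc h * suc s) k (rebase eq (solve (h ∷ s ∷ []))))
    ... | even p | odd h  = ⊥-elim (2*x≢4k+3 (suc (2 * p) * suc h) k (rebase eq (solve (p ∷ h ∷ []))))
    ... | even p | even q with <-cmp p q
    ...   | tri< p<q _ _ with o , refl ← m≤n⇒∃[o]m+o≡n p<q =
      inj₂ ((o , 2 * p) , rebase eq (solve (o ∷ p ∷ [])) , cong (2 * p ,_) (bigger p o))
    ...   | tri> _ _ q<p with o , refl ← m≤n⇒∃[o]m+o≡n q<p =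
      inj₁ ((o , 2 * q) , rebase eq (solve (o ∷ q ∷ [])) , cong (_, 2 * q) (bigger q o))
    ...   | tri≈ _ refl _ = ⊥-elim (x²+y²≢4k+3 (1 + 2 * p) 0 k (trans (+-identityʳ _) eq))

opaque
  Skew-even : ∀ k → Skew (4 * k + 3) # n → ∃ λ m → n ≡ 2 * m
  Skew-even k F with i , j , E , O , refl ← Skew-split F
    with b , Bey ← Beyond-4k+3 k
    with refl ← #-unique E (SkewEven-Beyond k Bey) | c , refl ← SkewOdd-even k O =
    b + c , sym (*-distribˡ-+ 2 b c)

opaque
  Beyond-2⟨4k+3⟩ : ∀ k → Beyond (2 * (4 * k + 3)) # n → ∃₂ λ j m → DivisorPairs (4 * k + 3) # j × n ≡ j + 2 * m
  Beyond-2⟨4k+3⟩ k F with i , j , N , S , refl ← Beyond-2⟨4k+3⟩-split k F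
    with d , m , D , refl ← Nested-mod2 N | m′ , refl ← Skew-even k S =
    d , m + m′ , D , trans (+-assoc d _ _) (cong (d +_) (sym (*-distribˡ-+ 2 m m′)))

-- Overpartitions as runs of equal parts

open import Data.List.Relation.Unary.All using ([]; _∷_)
open import Data.List.Relation.Unary.AllPairs using ([]; _∷_)

-- The enumeration of flagged compositions

Unique-concatMap : (h : A → List B) (key : B → A) → (∀ x → Unique (h x)) →
                   (∀ x {y} → y ∈ h x → key y ≡ x) → ∀ {xs} → Unique xs → Unique (concatMap h xs)
Unique-concatMap h key uh keyed {[]}     []        = []
Unique-concatMap h key uh keyed {x ∷ xs} (x∉ ∷ us) =
  Uniqueₚ.++⁺ (uh x) (Unique-concatMap h key uh keyed us) disjoint
  where
  disjoint : ∀ {y} → ¬ (y ∈ h x × y ∈ concatMap h xs)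
  -- The key recovers the block, so a common element would identify two distinct blocks.
  disjoint (y∈ , y∈′) with z , z∈ , y∈z ← find (∈-concatMap⁻ h {xs} y∈′) =
    All.lookup x∉ z∈ (trans (sym (keyed x y∈)) (keyed z y∈z))

total : List Part → ℕ
total []            = 0
total ((a , _) ∷ π) = a + total π

Positive : Pred (List Part) 0ℓ
Positive = All (λ p → 0 < proj₁ p)

Composition : ℕ → Pred (List Part) 0ℓ
Composition n π = total π ≡ n × Positive π

-- The body of the outer `concatMap` of `flaggedCompositionsF`, named so that membership in it can
-- be analysed; `suc m ∸ suc k` computes to `m ∸ k`.
extensions : ℕ → ℕ → ℕ → List (List Part)
extensions f m k =
  concatMap (λ b → map ((suc k , b) ∷_) (flaggedCompositionsF f (suc m ∸ suc k))) (true ∷ false ∷ [])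

∈-extensions⁺ : ∀ f m k b {ρ} → ρ ∈ flaggedCompositionsF f (m ∸ k) → (suc k , b) ∷ ρ ∈ extensions f m k
∈-extensions⁺ f m k true  ρ∈ = ∈-++⁺ˡ (∈-map⁺ _ ρ∈)
∈-extensions⁺ f m k false ρ∈ =
  ∈-++⁺ʳ (map ((suc k , true) ∷_) (flaggedCompositionsF f (m ∸ k))) (∈-++⁺ˡ (∈-map⁺ _ ρ∈))

∈-extensions⁻ : ∀ f m k {π} → π ∈ extensions f m k →
  ∃₂ λ b ρ → ρ ∈ flaggedCompositionsF f (m ∸ k) × π ≡ (suc k , b) ∷ ρ
∈-extensions⁻ f m k π∈ with ∈-++⁻ (map ((suc k , true) ∷_) (flaggedCompositionsF f (m ∸ k))) π∈
... | inj₁ π∈t with ρ , ρ∈ , eq ← ∈-map⁻ _ π∈t = true , ρ , ρ∈ , eq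
... | inj₂ π∈r with ∈-++⁻ (map ((suc k , false) ∷_) (flaggedCompositionsF f (m ∸ k))) π∈r
...   | inj₁ π∈f with ρ , ρ∈ , eq ← ∈-map⁻ _ π∈f = false , ρ , ρ∈ , eq

flaggedCompositionsF-sound : ∀ f m {π} → π ∈ flaggedCompositionsF f m → Composition m π
flaggedCompositionsF-sound _       zero    (here refl) = refl , []
flaggedCompositionsF-sound (suc f) (suc m) π∈
  with k , k∈ , π∈k ← find (∈-concatMap⁻ (extensions f m) {upTo (suc m)} π∈)
  with b , ρ , ρ∈ , refl ← ∈-extensions⁻ f m k π∈k
  with eq , pos ← flaggedCompositionsF-sound f (m ∸ k) ρ∈ =
  cong suc (trans (cong (k +_) eq) (m+[n∸m]≡n (s≤s⁻¹ (∈-upTo⁻ k∈)))) , z<s ∷ pos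

flaggedCompositionsF-complete : ∀ f m π → m ≤ f → Composition m π → π ∈ flaggedCompositionsF f m
flaggedCompositionsF-complete f       zero    []                  _         _            = here refl
flaggedCompositionsF-complete (suc f) (suc m) ((suc a , b) ∷ π) (s≤s m≤f) (eq , _ ∷ pos) =
  ∈-concatMap⁺ (extensions f m) (lose (∈-upTo⁺ (s≤s a≤m))
    (∈-extensions⁺ f m a b (flaggedCompositionsF-complete f (m ∸ a) π (≤-trans (m∸n≤m m a) m≤f) (eq′ , pos))))
  where
  a≤m : a ≤ m
  a≤m = subst (a ≤_) (suc-injective eq) (m≤m+n a _)
  eq′ : total π ≡ m ∸ a
  eq′ = sym (trans (cong (_∸ a) (sym (suc-injective eq))) (m+n∸m≡n a _))
flaggedCompositionsF-complete f zero    ((zero , _) ∷ _)  _ (_ , () ∷ _)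
flaggedCompositionsF-complete f (suc m) ((zero , _) ∷ _)  _ (_ , () ∷ _)

-- A key for `Unique-concatMap`. The predecessor matches the index `k` of a first part `suc k`; the
-- value at the empty list is arbitrary.
headSize : List Part → ℕ
headSize []            = 0
headSize ((a , _) ∷ _) = pred a

headFlag : List Part → Bool
headFlag []            = false
headFlag ((_ , b) ∷ _) = b

flaggedCompositionsF-unique : ∀ f m → Unique (flaggedCompositionsF f m)
flaggedCompositionsF-unique zero    zero    = [] ∷ []
flaggedCompositionsF-unique (suc f) zero    = [] ∷ []
flaggedCompositionsF-unique zero    (suc m) = []
flaggedCompositionsF-unique (suc f) (suc m) =
  Unique-concatMap (extensions f m) headSize uniqueExtensions keyed (Uniqueₚ.upTo⁺ (suc m))
  where
  uniqueExtensions : ∀ k → Unique (extensions f m k)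
  uniqueExtensions k = Unique-concatMap _ headFlag
    (λ b → Uniqueₚ.map⁺ (λ { refl → refl }) (flaggedCompositionsF-unique f (m ∸ k)))
    (λ b π∈ → cong headFlag (proj₂ (proj₂ (∈-map⁻ ((suc k , b) ∷_) π∈))))
    {true ∷ false ∷ []} (((λ ()) ∷ []) ∷ [] ∷ [])

  keyed : ∀ k {π} → π ∈ extensions f m k → headSize π ≡ k
  keyed k π∈ with _ , _ , _ , refl ← ∈-extensions⁻ f m k π∈ = refl

good : List Part → Bool
good π = isOverpartitionᵇ π ∧ isOmegaᵇ π

Overpartitions : ℕ → Pred (List Part) 0ℓ
Overpartitions n π = Composition n π × good π ≡ true

pω-counts : ∀ n → Overpartitions n # pω n
pω-counts n = record
  { elems    = filterᵇ good (flaggedCompositions n)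
  ; size     = refl
  ; unique   = Uniqueₚ.filter⁺ (T? ∘ good) (flaggedCompositionsF-unique n n)
  ; sound    = λ π∈ → let m , g = ∈-filter⁻ (T? ∘ good) {xs = flaggedCompositions n} π∈ in
                 flaggedCompositionsF-sound n n m , Equivalence.to T-≡ g
  ; complete = λ {π} (c , g) → ∈-filter⁺ (T? ∘ good)
                 (flaggedCompositionsF-complete n n π ≤-refl c) (Equivalence.from T-≡ g)
  }

-- The effect of a run of equal parts

prepend : ℕ → ℕ → List Part → List Part
prepend t zero    ρ = ρ
prepend t (suc j) ρ = (suc t , false) ∷ prepend t j ρ

-- j + 1 parts of size t + 1, the first one overlined according to f, followed by ρ.
run : ℕ → Bool → ℕ → List Part → List Part
run t f j ρ = (suc t , f) ∷ prepend t j ρ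

-- Strictly smaller than the size `suc t` of a run placed in front.
Below : ℕ → Pred (List Part) 0ℓ
Below t = All (λ p → proj₁ p ≤ t)

<ᵇ-true : ∀ {m n} → m < n → (m <ᵇ n) ≡ true
<ᵇ-true = Equivalence.to T-≡ ∘ <⇒<ᵇ

≡ᵇ-refl : ∀ n → (n ≡ᵇ n) ≡ true
≡ᵇ-refl n = Equivalence.to T-≡ (≡⇒≡ᵇ n n refl)

<⇒≢ᵇ : ∀ {m n} → m < n → (n ≡ᵇ m) ≡ false
<⇒≢ᵇ {m} {n} m<n with n ≡ᵇ m in eq
... | false = refl
... | true  = ⊥-elim (<⇒≢ m<n (sym (≡ᵇ⇒≡ n m (Equivalence.from T-≡ eq))))

marked admissible : ℕ → List Part → Bool
marked s = any (λ p → proj₂ p ∧ (proj₁ p ≡ᵇ s))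
admissible s = all (λ p → allowed (proj₁ p) s)

any-cong : {p q : A → Bool} → (∀ x → p x ≡ q x) → ∀ xs → any p xs ≡ any q xs
any-cong p≗q []       = refl
any-cong p≗q (x ∷ xs) = cong₂ _∨_ (p≗q x) (any-cong p≗q xs)

all-cong : {p q : A → Bool} → (∀ x → p x ≡ q x) → ∀ xs → all p xs ≡ all q xs
all-cong p≗q []       = refl
all-cong p≗q (x ∷ xs) = cong₂ _∧_ (p≗q x) (all-cong p≗q xs)

-- The pattern-matching functions inside `isOmegaᵇ` agree with those of `marked` and `admissible`
-- pointwise, hence the congruence along the tail.
isOmegaᵇ-≡ : ∀ p π → let s = smallestPart (p ∷ π) in
             isOmegaᵇ (p ∷ π) ≡ marked s (p ∷ π) ∧ admissible s (p ∷ π)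
isOmegaᵇ-≡ p π = cong₂ _∧_
  (cong ((proj₂ p ∧ (proj₁ p ≡ᵇ smallestPart (p ∷ π))) ∨_) (any-cong (λ _ → refl) π))
  (cong (allowed (proj₁ p) (smallestPart (p ∷ π)) ∧_) (all-cong (λ _ → refl) π))

-- Inside a run no part after the first is overlined, and the step from the run down to ρ is strict,
-- so no condition is added.
isOverpartitionᵇ-prepend : ∀ t f j {ρ} → Below t ρ → isOverpartitionᵇ (run t f j ρ) ≡ isOverpartitionᵇ ρ
isOverpartitionᵇ-prepend t f zero    {[]}     _         = refl
isOverpartitionᵇ-prepend t f zero    {_ ∷ ρ} (a≤t ∷ _) rewrite <ᵇ-true (s≤s a≤t) = refl
isOverpartitionᵇ-prepend t f (suc j) {ρ}     below
  rewrite ≡ᵇ-refl t | ∨-zeroʳ (t <ᵇ t) = isOverpartitionᵇ-prepend t false j below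

smallestPart-run-[] : ∀ t f j → smallestPart (run t f j []) ≡ suc t
smallestPart-run-[] t f zero    = refl
smallestPart-run-[] t f (suc j) rewrite smallestPart-run-[] t false j = ⊓-idem (suc t)

smallestPart-≤ : ∀ p π → smallestPart (p ∷ π) ≤ proj₁ p
smallestPart-≤ p []      = ≤-refl
smallestPart-≤ p (_ ∷ _) = m⊓n≤m (proj₁ p) _

smallestPart-run-∷ : ∀ t f j p ρ → proj₁ p ≤ t → smallestPart (run t f j (p ∷ ρ)) ≡ smallestPart (p ∷ ρ)
smallestPart-run-∷ t f zero    p ρ p≤t = m≥n⇒m⊓n≡n (≤-trans (smallestPart-≤ p ρ) (m≤n⇒m≤1+n p≤t))
smallestPart-run-∷ t f (suc j) p ρ p≤t rewrite smallestPart-run-∷ t false j p ρ p≤t =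
  m≥n⇒m⊓n≡n (≤-trans (smallestPart-≤ p ρ) (m≤n⇒m≤1+n p≤t))

marked-run : ∀ s t f j ρ → marked s (run t f j ρ) ≡ (f ∧ (suc t ≡ᵇ s)) ∨ marked s ρ
marked-run s t f j ρ = cong ((f ∧ (suc t ≡ᵇ s)) ∨_) (prepended j)
  where
  prepended : ∀ j → marked s (prepend t j ρ) ≡ marked s ρ
  prepended zero    = refl
  prepended (suc j) = prepended j

admissible-run : ∀ s t f j ρ → admissible s (run t f j ρ) ≡ allowed (suc t) s ∧ admissible s ρ
admissible-run s t f zero    ρ = refl
admissible-run s t f (suc j) ρ = trans (cong (x ∧_) (admissible-run s t false j ρ))
  (trans (sym (∧-assoc x x _)) (cong (_∧ admissible s ρ) (∧-idem x)))
  where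
  x : Bool
  x = allowed (suc t) s

isOmegaᵇ-run : ∀ t f j ρ {s} → smallestPart (run t f j ρ) ≡ s →
  isOmegaᵇ (run t f j ρ) ≡ ((f ∧ (suc t ≡ᵇ s)) ∨ marked s ρ) ∧ (allowed (suc t) s ∧ admissible s ρ)
isOmegaᵇ-run t f j ρ refl = trans (isOmegaᵇ-≡ (suc t , f) (prepend t j ρ))
  (cong₂ _∧_ (marked-run (smallestPart (run t f j ρ)) t f j ρ) (admissible-run (smallestPart (run t f j ρ)) t f j ρ))

-- A single size is the smallest one and lies below its double, so only the mark remains to be
-- checked.
good-run-[] : ∀ t f j → good (run t f j []) ≡ f
good-run-[] t f j = trans
  (cong₂ _∧_ (isOverpartitionᵇ-prepend t f j []) (isOmegaᵇ-run t f j [] (smallestPart-run-[] t f j)))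
  (simplify f (isEven (suc t)) (≡ᵇ-refl (suc t)) (<ᵇ-true (m<m+n (suc t) {suc t + 0} z<s)))
  where
  simplify : ∀ f x {y z} → y ≡ true → z ≡ true → ((f ∧ y) ∨ false) ∧ ((x ∨ z) ∧ true) ≡ f
  simplify false _     refl refl = refl
  simplify true  false refl refl = refl
  simplify true  true  refl refl = refl

-- A run over a nonempty remainder is not of the smallest size, so its overline does not count as
-- the mark. This independence of `f` is the source of the factors 2.
good-run-∷ : ∀ t f j p ρ → Below t (p ∷ ρ) →
             good (run t f j (p ∷ ρ)) ≡ allowed (suc t) (smallestPart (p ∷ ρ)) ∧ good (p ∷ ρ)
good-run-∷ t f j p ρ below@(p≤t ∷ _) = trans
  (cong₂ _∧_ (isOverpartitionᵇ-prepend t f j below) (isOmegaᵇ-run t f j (p ∷ ρ) (smallestPart-run-∷ t f j p ρ p≤t)))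
  (trans (simplify f (isOverpartitionᵇ (p ∷ ρ)) (allowed (suc t) s) (<⇒≢ᵇ (s≤s (≤-trans (smallestPart-≤ p ρ) p≤t))))
         (cong (λ x → allowed (suc t) s ∧ (isOverpartitionᵇ (p ∷ ρ) ∧ x)) (sym (isOmegaᵇ-≡ p ρ))))
  where
  s : ℕ
  s = smallestPart (p ∷ ρ)

  simplify : ∀ f w y {u x z} → u ≡ false → w ∧ (((f ∧ u) ∨ x) ∧ (y ∧ z)) ≡ y ∧ (w ∧ (x ∧ z))
  simplify false false false refl = refl
  simplify false false true  refl = refl
  simplify false true  true  refl = refl
  simplify true  false false refl = refl
  simplify true  false true  refl = refl
  simplify true  true  true  refl = refl
  simplify false true  false {x = x} refl = ∧-zeroʳ x
  simplify true  true  false {x = x} refl = ∧-zeroʳ x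

-- `Below` keeps parts of size `suc t` out of the remainders, so the list shows where the run ends.
prepend-injective : ∀ t i j {ρ σ} → Below t ρ → Below t σ → prepend t i ρ ≡ prepend t j σ → i ≡ j × ρ ≡ σ
prepend-injective t zero    zero    _ _ eq = refl , eq
prepend-injective t (suc i) (suc j) p q eq with refl , eq′ ← prepend-injective t i j p q (∷-injectiveʳ eq) = refl , eq′
prepend-injective t zero    (suc j) (p ∷ _) _ refl = ⊥-elim (1+n≰n p)
prepend-injective t (suc i) zero    _ (q ∷ _) refl = ⊥-elim (1+n≰n q)

run-injective : ∀ {t f j ρ t′ f′ j′ ρ′} → Below t ρ → Below t′ ρ′ → run t f j ρ ≡ run t′ f′ j′ ρ′ →
                (f , t , j , ρ) ≡ (f′ , t′ , j′ , ρ′)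
run-injective {t} {j = j} {j′ = j′} p q eq with refl ← ∷-injectiveˡ eq
  with refl , refl ← prepend-injective t j j′ p q (∷-injectiveʳ eq) = refl

Below-prepend : ∀ t j {u ρ} → suc t ≤ u → Below t ρ → Below u (prepend t j ρ)
Below-prepend t zero    t<u below = All.map (λ p≤t → ≤-trans p≤t (<⇒≤ t<u)) below
Below-prepend t (suc j) t<u below = t<u ∷ Below-prepend t j t<u below

Positive-prepend : ∀ t j {ρ} → Positive ρ → Positive (prepend t j ρ)
Positive-prepend t zero    pos = pos
Positive-prepend t (suc j) pos = z<s ∷ Positive-prepend t j pos

Positive-prepend⁻ : ∀ t j {ρ} → Positive (prepend t j ρ) → Positive ρ
Positive-prepend⁻ t zero    pos       = pos
Positive-prepend⁻ t (suc j) (_ ∷ pos) = Positive-prepend⁻ t j pos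

total-run : ∀ t f j ρ → total (run t f j ρ) ≡ suc j * suc t + total ρ
total-run t f zero    ρ = cong (λ x → suc x + total ρ) (sym (+-identityʳ t))
total-run t f (suc j) ρ = trans (cong (suc t +_) (total-run t false j ρ)) (sym (+-assoc (suc t) (suc j * suc t) (total ρ)))

-- Decomposition by the largest part sizes

data Runs : Pred (List Part) 0ℓ where
  runs : ∀ t f j ρ → Below t ρ → Runs (run t f j ρ)

-- Either the next part is smaller and the run consists of one part, or it is equal and not
-- overlined and the first run of the tail grows by one.
extendRun : ∀ t f a b π → isOverpartitionᵇ ((suc t , f) ∷ (a , b) ∷ π) ≡ true →
            (isOverpartitionᵇ ((a , b) ∷ π) ≡ true → Runs ((a , b) ∷ π)) → Runs ((suc t , f) ∷ (a , b) ∷ π)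
extendRun t f a b π over rest with a <ᵇ suc t in lt
... | true with a<t ← <ᵇ⇒< a (suc t) (Equivalence.from T-≡ lt) with rest over
...   | runs t′ _ j ρ below = runs t f 0 _ (s≤s⁻¹ a<t ∷ Below-prepend t′ j (s≤s⁻¹ a<t) below)
extendRun t f a b π over rest | false with a ≡ᵇ suc t in eq | b
... | true | false with refl ← ≡ᵇ⇒≡ a (suc t) (Equivalence.from T-≡ eq) with rest over
...   | runs _ _ j ρ below = runs t f (suc j) ρ below

firstRun : ∀ p π → Positive (p ∷ π) → isOverpartitionᵇ (p ∷ π) ≡ true → Runs (p ∷ π)
firstRun (zero  , f) _             (() ∷ _)  _
firstRun (suc t , f) []            _         _    = runs t f 0 [] []
firstRun (suc t , f) ((a , b) ∷ π) (_ ∷ pos) over = extendRun t f a b π over (firstRun (a , b) π pos)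

-- `good ρ` rules out the empty list.
smallestPart-run : ∀ t f j ρ → Below t ρ → good ρ ≡ true → smallestPart (run t f j ρ) ≡ smallestPart ρ
smallestPart-run t f j (p ∷ ρ) (p≤t ∷ _) _ = smallestPart-run-∷ t f j p ρ p≤t

Stack : Pred (ℕ × ℕ × List Part) 0ℓ
Stack (t , j , ρ) = Below t ρ × Positive ρ × good ρ ≡ true × allowed (suc t) (smallestPart ρ) ≡ true

Stack-good : ∀ {t j ρ} f → Stack (t , j , ρ) → good (run t f j ρ) ≡ true
Stack-good {t} {j} {p ∷ ρ} f (below , _ , g , al) = trans (good-run-∷ t f j p ρ below) (cong₂ _∧_ al g)

Layered : ℕ → Pred (ℕ × ℕ × List Part) 0ℓ
Layered n (t , j , ρ) = Stack (t , j , ρ) × suc j * suc t + total ρ ≡ n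

-- Two runs over a nonempty remainder: three or more part sizes, with the flags of the two largest
-- forgotten.
DoublyLayered : ℕ → Pred ((ℕ × ℕ × List Part) × ℕ × ℕ) 0ℓ
DoublyLayered n ((t′ , j′ , ρ) , t , j) =
  Stack (t′ , j′ , ρ) × t′ < t × allowed (suc t) (smallestPart ρ) ≡ true ×
  suc j * suc t + (suc j′ * suc t′ + total ρ) ≡ n

opaque
  forget-flag : {P : Pred A 0ℓ} → (λ (x : Bool × A) → P (proj₂ x)) # k → ∃ λ j → P # j × k ≡ 2 * j
  forget-flag {A = A} {P = P} = #-twice ∘ #-split (true ,_) (false ,_) cover (λ _ → id) (λ _ → id)
    (λ { _ _ _ _ refl → refl }) (λ { _ _ _ _ refl → refl }) (λ _ _ _ _ ())
    where
    cover : ∀ x → P (proj₂ x) → (∃ λ y → P y × (true , y) ≡ x) ⊎ (∃ λ z → P z × (false , z) ≡ x)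
    cover (true  , y) p = inj₁ (y , p , refl)
    cover (false , z) p = inj₂ (z , p , refl)

∧-true : ∀ {x y} → x ∧ y ≡ true → x ≡ true × y ≡ true
∧-true {true} {true} _ = refl , refl

good-isOverpartition : ∀ {π} → good π ≡ true → isOverpartitionᵇ π ≡ true
good-isOverpartition g = proj₁ (∧-true g)

data Shape : Pred (List Part) 0ℓ where
  single : ∀ t j → Shape (run t true j [])
  stack  : ∀ t f j ρ → Stack (t , j , ρ) → Shape (run t f j ρ)

shape : ∀ {π} → Positive π → good π ≡ true → Shape π
shape {p ∷ π} pos g with runs t f j ρ below ← firstRun p π pos (good-isOverpartition {p ∷ π} g) = split ρ below pos g
  where
  split : ∀ ρ → Below t ρ → Positive (run t f j ρ) → good (run t f j ρ) ≡ true → Shape (run t f j ρ)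
  split []      below pos       g with refl ← trans (sym (good-run-[] t f j)) g = single t j
  split (q ∷ ρ) below (_ ∷ pos) g with al , g′ ← ∧-true (trans (sym (good-run-∷ t f j q ρ below)) g) =
    stack t f j (q ∷ ρ) (below , Positive-prepend⁻ t j pos , g′ , al)

opaque
  -- A single part size forces the overline and leaves a factorisation of n; otherwise the flag of
  -- the largest size is free.
  Overpartitions-split : Overpartitions n # k →
    ∃₂ λ i j → Divisors n # i × (λ (x : Bool × (ℕ × ℕ × List Part)) → Layered n (proj₂ x)) # j × k ≡ i + j
  Overpartitions-split {n} = #-split f g cover presf presg injf injg disj
    where
    f : ℕ² → List Part
    f (c , s) = run s true c []

    g : Bool × (ℕ × ℕ × List Part) → List Part
    g (b , (t , j , ρ)) = run t b j ρ

    presf : ∀ y → Divisors n y → Overpartitions n (f y)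
    presf (c , s) eq = (trans (total-run s true c []) (trans (+-identityʳ _) eq) , z<s ∷ Positive-prepend s c []) ,
      good-run-[] s true c

    presg : ∀ y → Layered n (proj₂ y) → Overpartitions n (g y)
    presg (b , (t , j , ρ)) (st@(_ , pos , _) , eq) =
      (trans (total-run t b j ρ) eq , z<s ∷ Positive-prepend t j pos) , Stack-good {t} {j} {ρ} b st

    injf : InjectiveOn (Divisors n) f
    injf _ _ _ _ eq with refl ← run-injective [] [] eq = refl

    injg : InjectiveOn (λ x → Layered n (proj₂ x)) g
    injg _ _ ((below , _) , _) ((below′ , _) , _) eq with refl ← run-injective below below′ eq = refl

    disj : ∀ y z → Divisors n y → Layered n (proj₂ z) → f y ≢ g z
    disj _ _ _ ((below , _ , g , _) , _) eq with refl ← run-injective [] below eq with () ← g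

    cover : ∀ x → Overpartitions n x →
      (∃ λ y → Divisors n y × f y ≡ x) ⊎ (∃ λ z → Layered n (proj₂ z) × g z ≡ x)
    cover π ((eq , pos) , gd) with shape pos gd
    ... | single t j       = inj₁ ((j , t) , trans (sym (trans (total-run t true j []) (+-identityʳ _))) eq , refl)
    ... | stack t b j ρ st = inj₂ ((b , (t , j , ρ)) , (st , trans (sym (total-run t b j ρ)) eq) , refl)

opaque
  -- The second largest size is treated likewise: if it is also the smallest its overline is forced,
  -- otherwise its flag is free.
  Layered-split : Layered n # k →
    ∃₂ λ i j → TwoSizes n # i ×
      (λ (x : Bool × ((ℕ × ℕ × List Part) × ℕ × ℕ)) → DoublyLayered n (proj₂ x)) # j × k ≡ i + j
  Layered-split {n} = #-split f g cover presf presg injf injg disj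
    where
    f : ℕ⁴ → ℕ × ℕ × List Part
    f (a , s , b , t) = t , b , run s true a []

    g : Bool × ((ℕ × ℕ × List Part) × ℕ × ℕ) → ℕ × ℕ × List Part
    g (b , (t′ , j′ , ρ) , t , j) = t , j , run t′ b j′ ρ

    total₂ : ∀ a s b t → suc b * suc t + total (run s true a []) ≡ suc a * suc s + suc b * suc t
    total₂ a s b t = trans (cong (suc b * suc t +_) (trans (total-run s true a []) (+-identityʳ _)))
      (+-comm (suc b * suc t) (suc a * suc s))

    presf : ∀ y → TwoSizes n y → Layered n (f y)
    presf (a , s , b , t) (eq , s<t , al) =
      (s<t ∷ Below-prepend s a s<t [] , z<s ∷ Positive-prepend s a [] , good-run-[] s true a ,
       trans (cong (allowed (suc t)) (smallestPart-run-[] s true a)) al) ,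
      trans (total₂ a s b t) eq

    presg : ∀ y → DoublyLayered n (proj₂ y) → Layered n (g y)
    presg (b , (t′ , j′ , ρ) , t , j) (st@(below , pos , gd , _) , t′<t , al , eq) =
      (t′<t ∷ Below-prepend t′ j′ t′<t below , z<s ∷ Positive-prepend t′ j′ pos , Stack-good {t′} {j′} {ρ} b st ,
       trans (cong (allowed (suc t)) (smallestPart-run t′ b j′ ρ below gd)) al) ,
      trans (cong (suc j * suc t +_) (total-run t′ b j′ ρ)) eq

    injf : InjectiveOn (TwoSizes n) f
    injf _ _ _ _ eq with refl , eq₂ ← pair⁻ eq with refl , eq₃ ← pair⁻ eq₂
      with refl ← run-injective [] [] eq₃ = refl

    injg : InjectiveOn (λ x → DoublyLayered n (proj₂ x)) g
    injg _ _ ((below , _) , _) ((below′ , _) , _) eq with refl , eq₂ ← pair⁻ eq with refl , eq₃ ← pair⁻ eq₂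
      with refl ← run-injective below below′ eq₃ = refl

    disj : ∀ y z → TwoSizes n y → DoublyLayered n (proj₂ z) → f y ≢ g z
    disj _ _ _ ((below , _ , gd , _) , _) eq with refl , eq₂ ← pair⁻ eq with refl , eq₃ ← pair⁻ eq₂
      with refl ← run-injective [] below eq₃ with () ← gd

    cover : ∀ x → Layered n x →
      (∃ λ y → TwoSizes n y × f y ≡ x) ⊎ (∃ λ z → DoublyLayered n (proj₂ z) × g z ≡ x)
    cover (t , j , π) ((below , pos , gd , al) , eq) with shape pos gd
    ... | single s a = inj₁ ((a , s , j , t) ,
            (trans (sym (total₂ a s j t)) eq , All.head below ,
             trans (cong (allowed (suc t)) (sym (smallestPart-run-[] s true a))) al) , refl)
    ... | stack t′ b j′ ρ st@(below′ , _ , gd′ , _) = inj₂ ((b , (t′ , j′ , ρ) , t , j) ,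
            (st , All.head below , trans (cong (allowed (suc t)) (sym (smallestPart-run t′ b j′ ρ below′ gd′))) al ,
             trans (cong (suc j * suc t +_) (sym (total-run t′ b j′ ρ))) eq) , refl)

-- The congruences modulo 4

opaque
  pω-mod4 : ∀ n → ∃₂ λ d k → ∃ λ m → Divisors n # d × TwoSizes n # k × pω n ≡ d + 2 * k + 4 * m
  pω-mod4 n with d , l , D , L , eq ← Overpartitions-split (pω-counts n)
    with l′ , L′ , refl ← forget-flag L
    with k , q , K , Q , refl ← Layered-split L′
    with m , _ , refl ← forget-flag Q =
    d , k , m , D , K , trans eq (trans (cong (d +_) (trans (*-distribˡ-+ 2 k (2 * m)) (cong (2 * k +_) (sym (*-assoc 2 2 m)))))
      (sym (+-assoc d (2 * k) (4 * m))))

opaque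
  pω-4k+3 : ∀ k → ∃ λ q → pω (4 * k + 3) ≡ 4 * q
  pω-4k+3 k with d , κ , m , D , K , eq ← pω-mod4 (4 * k + 3)
    with _ , _ , C , F , refl ← TwoSizes-split K
    with c , refl ← Close-even (λ x y → x²+y²≢4k+3 x y k) C | _ , _ , Dbl , Bey , refl ← Far-split F
    with j , u , D₃ , refl ← Double-mod2 (λ x p → 2*x≢4k+3 (2 * x) k (trans (sym (*-assoc 2 2 x)) p)) Dbl
    with _ , D₃′ , refl ← Divisors-4k+3 k D | b , Bey′ ← Beyond-4k+3 k
    with refl ← #-unique D₃ D₃′ | refl ← #-unique Bey Bey′ =
    -- τ(n) = 2 j, and the solutions with t = 2 s contribute another 2 j modulo 4; the remaining
    -- terms are multiples of 4.
    j + c + u + b + m , trans eq (regroup j c u b m)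
    where
    regroup : ∀ j c u b m → 2 * j + 2 * (2 * c + ((j + 2 * u) + 2 * b)) + 4 * m ≡ 4 * (j + c + u + b + m)
    regroup = solve-∀

opaque
  pω-2⟨4k+3⟩ : ∀ k → ∃ λ q → pω (2 * (4 * k + 3)) ≡ 4 * q
  pω-2⟨4k+3⟩ k with d , κ , m , D , K , eq ← pω-mod4 (2 * (4 * k + 3))
    with _ , _ , C , F , refl ← TwoSizes-split K
    with c , refl ← Close-even (λ x y → x²+y²≢2⟨4k+3⟩ x y k) C | _ , _ , Dbl , Bey , refl ← Far-split F
    with j , u , D₃ , refl ← Double-mod2 (λ x → 4*x≢2⟨4k+3⟩ x k) Dbl
    with p , v , DP , refl ← Beyond-2⟨4k+3⟩ k Bey | e , E , refl ← Divisors-2⟨4k+3⟩ k D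
    with _ , D₃′ , e≡2j ← Divisors-4k+3 k E | _ , DP′ , e≡2p ← Divisors-pairs k E
    with refl ← #-unique (Divisors₃-2⟨4k+3⟩ k D₃) D₃′ | refl ← #-unique DP DP′
    with refl ← halve-≡ {j} {p} (trans (sym e≡2j) e≡2p) | refl ← e≡2j =
    -- τ(n) = 2 τ(4k+3) = 4 j, while the solutions with t = 2 s and those with t > 2 s each
    -- contribute 2 j modulo 4.
    2 * j + c + u + v + m , trans eq (regroup j c u v m)
    where
    regroup : ∀ j c u v m →
      2 * (2 * j) + 2 * (2 * c + ((j + 2 * u) + (j + 2 * v))) + 4 * m ≡ 4 * (2 * j + c + u + v + m)
    regroup = solve-∀

theorem1p4 : (n : ℕ) → (4 ∣ pω (4 * n + 3)) × (4 ∣ pω (8 * n + 6))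
theorem1p4 n = four∣ (pω-4k+3 n) , subst (λ x → 4 ∣ pω x) (twice n) (four∣ (pω-2⟨4k+3⟩ n))
  where
  four∣ : ∀ {x} → (∃ λ q → x ≡ 4 * q) → 4 ∣ x
  four∣ (q , eq) = divides q (trans eq (*-comm 4 q))

  twice : ∀ n → 2 * (4 * n + 3) ≡ 8 * n + 6
  twice = solve-∀
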